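{- Let $M$ be a matroid on $S$ with primary flag $T_0\subset\cdots\subset T_k$. Then the sequence of primary factors $M(T_0,T_1),\dots,M(T_{k-1},T_k)$ is the unique sequence $M_1,\dots,M_k$ of nonempty matroids such that $M=M_1\mathbin{\Box}\cdots\mathbin{\Box} M_k$, each $M_i$ is either irreducible or uniform, and no free product of (two or more) consecutive $M_i$'s is uniform.
   Context: For a matroid $M$ on $S$, $\rho(M)$ is its rank, $\nu_M(A)=|A|-\rho_M(A)$, $\lambda_M(A)=\rho(M)-\rho_M(A)$. For matroids $M$ on $S$ and $N$ on $T$ with $S\cap T=\emptyset$, the free product $M\mathbin{\Box} N$ is the matroid on $S\cup T$ whose independent sets are the $A\subseteq S\cup T$ with $A\cap S$ independent in $M$ and $\lambda_M(A\cap S)\geq\nu_N(A\cap T)$; it is associative. A nonempty matroid is irreducible if every factorization of it as a free product contains it as a factor. For $A\subseteq B\subseteq S$, $M(A,B)$ denotes the minor $(M|B)/A$ on $B\setminus A$. A cyclic flat is a flat that is a union of circuits; $\mathcal{D}(M)$ is the complete sublattice of $2^S$ generated by the cyclic flats (containing $\emptyset$ and $S$). A pinchpoint of a poset is an element comparable to every element. The primary flag of $M$ is the chain $T_0\subset\cdots\subset T_k$ of all pinchpoints of $\mathcal{D}(M)$ (so $T_0=\emptyset$, $T_k=S$), and the primary factors are the minors $M(T_{i-1},T_i)$, $1\le i\le k$. -}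

module Defs where

open import Data.Nat using (ℕ; zero; suc; _+_; _∸_; _≤_; _<_; _⊔_; _≤ᵇ_; _≡ᵇ_)
open import Data.Bool using (Bool; true; false; _∧_; if_then_else_)
open import Data.Fin using (Fin)
open import Data.Fin.Subset
  using (Subset; inside; outside; _∈_; _∉_; _⊆_; _⊂_; _∪_; _∩_; _─_; ∣_∣; Nonempty; Empty; ⁅_⁆)
  renaming (⊥ to ∅; ⊤ to Full)
open import Data.Fin.Subset.Properties using (_⊆?_)
open import Data.List using (List; []; _∷_; [_]; map; _++_; foldr; length; take; drop)
open import Data.List.Relation.Unary.All using (All)
open import Data.List.Relation.Unary.Any using (Any)
open import Data.List.Relation.Unary.AllPairs using (AllPairs)
open import Data.List.Relation.Binary.Pointwise using (Pointwise)
open import Data.List.Membership.Propositional using () renaming (_∈_ to _∈ₗ_)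
open import Data.Vec using (Vec; []; _∷_)
open import Data.Product using (Σ; ∃; _×_; _,_)
open import Data.Sum using (_⊎_)
open import Relation.Nullary using (¬_)
open import Relation.Nullary.Decidable using (⌊_⌋)
open import Relation.Binary.PropositionalEquality using (_≡_; _≢_)
open import Function.Bundles using (_⇔_)

-- All matroids live inside the fixed finite universe Fin n; a ground set is a
-- Subset n.  A "raw matroid" is a ground set together with a (decidable)
-- independence predicate; IsMatroid states the independence axioms.
record RawMatroid (n : ℕ) : Set where
  constructor mkRaw
  field
    ground : Subset n
    indep  : Subset n → Bool
open RawMatroid public

Indep : ∀ {n} → RawMatroid n → Subset n → Set
Indep M A = indep M A ≡ true

record IsMatroid {n : ℕ} (M : RawMatroid n) : Set where
  field
    indep⊆ground : ∀ A → Indep M A → A ⊆ ground M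
    indep-∅      : Indep M ∅
    hereditary   : ∀ A B → A ⊆ B → Indep M B → Indep M A
    augment      : ∀ A B → Indep M A → Indep M B → ∣ A ∣ < ∣ B ∣ →
                   Σ (Fin n) λ x → x ∈ B × x ∉ A × Indep M (A ∪ ⁅ x ⁆)

_≅_ : ∀ {n} → RawMatroid n → RawMatroid n → Set
M ≅ N = (ground M ≡ ground N) × (∀ A → indep M A ≡ indep N A)

NonemptyM : ∀ {n} → RawMatroid n → Set
NonemptyM M = Nonempty (ground M)

allSubsets : ∀ n → List (Subset n)
allSubsets zero = [ [] ]
allSubsets (suc n) = map (outside ∷_) (allSubsets n) ++ map (inside ∷_) (allSubsets n)

rank : ∀ {n} → RawMatroid n → Subset n → ℕ
rank {n} M A = foldr step 0 (allSubsets n)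
  where
  step : Subset n → ℕ → ℕ
  step B r = if ⌊ B ⊆? A ⌋ ∧ indep M B then ∣ B ∣ ⊔ r else r

rk : ∀ {n} → RawMatroid n → ℕ
rk M = rank M (ground M)

ν : ∀ {n} → RawMatroid n → Subset n → ℕ
ν M A = ∣ A ∣ ∸ rank M A

λM : ∀ {n} → RawMatroid n → Subset n → ℕ
λM M A = rk M ∸ rank M A

-- free product M □ N (intended for disjoint ground sets)
infixr 5 _□_
_□_ : ∀ {n} → RawMatroid n → RawMatroid n → RawMatroid n
M □ N = mkRaw (ground M ∪ ground N)
  (λ A → ⌊ A ⊆? (ground M ∪ ground N) ⌋
         ∧ indep M (A ∩ ground M)
         ∧ (ν N (A ∩ ground N) ≤ᵇ λM M (A ∩ ground M)))

emptyM : ∀ {n} → RawMatroid n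
emptyM {n} = mkRaw ∅ (λ A → ⌊ A ⊆? ∅ ⌋)

-- M₁ □ (M₂ □ (⋯ □ Mₖ))   (□ is associative)
FreeProd : ∀ {n} → List (RawMatroid n) → RawMatroid n
FreeProd = foldr _□_ emptyM

Disjoint : ∀ {n} → Subset n → Subset n → Set
Disjoint A B = Empty (A ∩ B)

DisjointGrounds : ∀ {n} → List (RawMatroid n) → Set
DisjointGrounds = AllPairs (λ M N → Disjoint (ground M) (ground N))

IsFactorization : ∀ {n} → RawMatroid n → List (RawMatroid n) → Set
IsFactorization M Ns = All IsMatroid Ns × DisjointGrounds Ns × (M ≅ FreeProd Ns)

Irreducible : ∀ {n} → RawMatroid n → Set
Irreducible M = NonemptyM M ×
  (∀ Ns → IsFactorization M Ns → Any (λ N → N ≅ M) Ns)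

Uniform : ∀ {n} → RawMatroid n → Set
Uniform M = Σ ℕ λ r → ∀ A → A ⊆ ground M → (Indep M A ⇔ (∣ A ∣ ≤ r))

-- minor M(A,B) = (M|B)/A on B ∖ A  (for A ⊆ B):
-- I ⊆ B∖A is independent iff ρ_M(I ∪ A) = |I| + ρ_M(A)
minor : ∀ {n} → RawMatroid n → Subset n → Subset n → RawMatroid n
minor M A B = mkRaw (B ─ A)
  (λ I → ⌊ I ⊆? (B ─ A) ⌋ ∧ (rank M (I ∪ A) ≡ᵇ (∣ I ∣ + rank M A)))

IsFlat : ∀ {n} → RawMatroid n → Subset n → Set
IsFlat M A = A ⊆ ground M ×
  (∀ x → x ∈ ground M → x ∉ A → rank M A < rank M (A ∪ ⁅ x ⁆))

IsCircuit : ∀ {n} → RawMatroid n → Subset n → Set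
IsCircuit M C = C ⊆ ground M × ¬ Indep M C × (∀ D → D ⊂ C → Indep M D)

IsCyclic : ∀ {n} → RawMatroid n → Subset n → Set
IsCyclic {n} M A = ∀ x → x ∈ A → Σ (Subset n) λ C → IsCircuit M C × C ⊆ A × x ∈ C

IsCyclicFlat : ∀ {n} → RawMatroid n → Subset n → Set
IsCyclicFlat M A = IsFlat M A × IsCyclic M A

-- 𝒟(M): the (complete) sublattice of 2^S generated by the cyclic flats,
-- containing ∅ and S (finite setting: closure under ∪, ∩, plus ∅ and S)
data InD {n} (M : RawMatroid n) : Subset n → Set where
  cf    : ∀ {A} → IsCyclicFlat M A → InD M A
  bot   : InD M ∅
  top   : InD M (ground M)
  join  : ∀ {A B} → InD M A → InD M B → InD M (A ∪ B)
  meet  : ∀ {A B} → InD M A → InD M B → InD M (A ∩ B)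

IsPinchpoint : ∀ {n} → RawMatroid n → Subset n → Set
IsPinchpoint M X = InD M X × (∀ Y → InD M Y → X ⊆ Y ⊎ Y ⊆ X)

data StrictChain {n} : List (Subset n) → Set where
  nil  : StrictChain []
  one  : ∀ {A} → StrictChain (A ∷ [])
  cons : ∀ {A B Ts} → A ⊂ B → StrictChain (B ∷ Ts) → StrictChain (A ∷ B ∷ Ts)

IsPrimaryFlag : ∀ {n} → RawMatroid n → List (Subset n) → Set
IsPrimaryFlag M Ts = StrictChain Ts × (∀ X → (X ∈ₗ Ts ⇔ IsPinchpoint M X))

factors : ∀ {n} → RawMatroid n → List (Subset n) → List (RawMatroid n)
factors M [] = []
factors M (A ∷ []) = []
factors M (A ∷ B ∷ Ts) = minor M A B ∷ factors M (B ∷ Ts)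

GoodDecomposition : ∀ {n} → RawMatroid n → List (RawMatroid n) → Set
GoodDecomposition M Ms =
  IsFactorization M Ms ×
  All NonemptyM Ms ×
  All (λ Mi → Irreducible Mi ⊎ Uniform Mi) Ms ×
  (∀ i j → i + 2 ≤ j → j ≤ length Ms → ¬ Uniform (FreeProd (take (j ∸ i) (drop i Ms))))

{-# OPTIONS --safe #-}
module Submission where

open import Defs
open import Data.Nat using (ℕ; zero; suc; _+_; _∸_; _≤_; _<_; _⊔_; _≤ᵇ_; z≤n; s≤s)
open import Data.Nat.Properties
open import Data.Bool using (Bool; true; false; _∧_; _∨_; not; if_then_else_; T)
open import Data.Bool.Properties using () renaming (_≟_ to _≟ᵇ_)
open import Data.Fin using (Fin; zero; suc)
open import Data.Fin.Properties using (any?; all?)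
open import Data.Fin.Subset
  using (Subset; inside; outside; _∈_; _∉_; _⊆_; _⊂_; _∪_; _∩_; _─_; ∣_∣; Empty; ⁅_⁆)
  renaming (⊥ to ∅)
open import Data.Fin.Subset.Properties
open import Data.List using (List; []; _∷_; map; _++_; foldr; length; take; drop)
open import Data.Bool.ListAction using (all)
open import Data.List.Properties using (foldr-cong; ++-assoc; length-++; length-take; length-drop; take++drop≡id)
open import Data.List.Membership.Propositional using () renaming (_∈_ to _∈ₗ_)
open import Data.List.Membership.Propositional.Properties using (∈-++⁺ˡ; ∈-++⁺ʳ; ∈-map⁺)
open import Data.List.Relation.Unary.All using (All; []; _∷_)
open import Data.List.Relation.Unary.Any using (Any; here; there)
open import Data.List.Relation.Unary.All.Properties using (++⁻ˡ; ++⁻ʳ)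
open import Data.List.Relation.Unary.AllPairs using ([]; _∷_)
open import Data.List.Relation.Binary.Pointwise using (Pointwise; []; _∷_)
open import Data.Vec as Vec using (Vec; []; _∷_; lookup)
open import Data.Vec.Properties
  using (lookup-zipWith; lookup-map; lookup-replicate; []=⇒lookup; lookup⇒[]=; ≡-dec)
open import Data.Product using (∃; _×_; _,_; proj₁; proj₂)
open import Data.Sum using (_⊎_; inj₁; inj₂; swap)
open import Data.Empty using (⊥; ⊥-elim)
open import Data.Unit using (tt)
open import Function using (case_of_; _⇔_; mk⇔; Equivalence)
open import Relation.Nullary using (¬_; Dec; yes; no; contradiction)
open import Relation.Nullary.Decidable using (⌊_⌋; _×-dec_; _→-dec_; ¬?; map′; decidable-stable)
open import Relation.Binary.PropositionalEquality
  using (_≡_; _≢_; refl; sym; trans; cong; cong₂; subst; subst₂)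

-- Call X a free separator of M if it is comparable to every cyclic flat. Then M(A,C) = M(A,B) □ M(B,C)
-- whenever A ⊆ B ⊆ C and B is a free separator: if I is dependent over A but I ∩ B is not, the closure
-- of a circuit in I plus a basis of A is a cyclic flat not inside B, so B lies in the span of I ∪ A.
-- Conversely, for free separators A ⊆ C, a factorization M(A,C) = P □ Q cuts at a free separator B.
-- Hence factorizations of M correspond to chains of free separators from ∅ to S. For free separators
-- A ⊆ B, the minor M(A,B) is uniform exactly when every cyclic flat lies below A or above B, and a
-- free separator outside 𝒟(M) lies between two pinchpoints with this property. So the factors of a
-- chain are irreducible or uniform, with no uniform product of consecutive ones, exactly when the
-- chain consists of all pinchpoints.

-- If `Gap M U V` holds with `V` in the ground set, every set between `U` and `V` is a free
-- separator. The pinchpoints around a free separator `B` are explicit: the union of the cyclic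
-- flats inside `B`, and the intersection of the ground set with the cyclic flats containing `B`. No
-- pinchpoint can be skipped: one strictly inside a factor would split it, against irreducibility,
-- or would lie in the gap that uniformity creates.
--
-- No closure operator is used: `X ⊆ Y` together with `r Y ≤ r X` expresses that `X` spans `Y`.
-- Nullity and corank are truncated differences, so every rank condition is first brought into an
-- additive form; independence in a free product of consecutive minors then becomes independence of
-- the part inside `B` plus one inequality between ranks in `M`.

private
  variable
    n k : ℕ

-- Boolean set algebra by truth tables

infixr 7 _∩ᵗ_
infixr 6 _∪ᵗ_
infixl 5 _─ᵗ_
infix 4 _⊑_ _≐_
infix 2 _⊢_ ⊢_
infixr 1 _,,_

data Term (k : ℕ) : Set where
  var            : Fin k → Term k
  ∅ᵗ             : Term k
  _∪ᵗ_ _∩ᵗ_ _─ᵗ_ : Term k → Term k → Term k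

data Formula (k : ℕ) : Set where
  _⊑_ _≐_ : Term k → Term k → Formula k

data Sequent (k : ℕ) : Set where
  ⊢_   : Formula k → Sequent k
  _,,_ : Formula k → Sequent k → Sequent k

_⊢_ : Formula k → Formula k → Sequent k
h ⊢ g = h ,, (⊢ g)

pattern #0 = var zero
pattern #1 = var (suc zero)
pattern #2 = var (suc (suc zero))
pattern #3 = var (suc (suc (suc zero)))
pattern #4 = var (suc (suc (suc (suc zero))))

⟦_⟧ : Term k → Vec (Subset n) k → Subset n
⟦ var i ⟧ ρ  = lookup ρ i
⟦ ∅ᵗ ⟧ ρ     = ∅
⟦ s ∪ᵗ t ⟧ ρ = ⟦ s ⟧ ρ ∪ ⟦ t ⟧ ρ
⟦ s ∩ᵗ t ⟧ ρ = ⟦ s ⟧ ρ ∩ ⟦ t ⟧ ρ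
⟦ s ─ᵗ t ⟧ ρ = ⟦ s ⟧ ρ ─ ⟦ t ⟧ ρ

Holds : Formula k → Vec (Subset n) k → Set
Holds (s ⊑ t) ρ = ⟦ s ⟧ ρ ⊆ ⟦ t ⟧ ρ
Holds (s ≐ t) ρ = ⟦ s ⟧ ρ ≡ ⟦ t ⟧ ρ

Meaning : Sequent k → Vec (Subset n) k → Set
Meaning (⊢ g)    ρ = Holds g ρ
Meaning (h ,, s) ρ = Holds h ρ → Meaning s ρ

bit : Term k → Vec Bool k → Bool
bit (var i)  β = lookup β i
bit ∅ᵗ       β = false
bit (s ∪ᵗ t) β = bit s β ∨ bit t β
bit (s ∩ᵗ t) β = bit s β ∧ bit t β
bit (s ─ᵗ t) β = bit s β ∧ not (bit t β)

_⇒ᵇ_ _⇔ᵇ_ : Bool → Bool → Bool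
a ⇒ᵇ b = not a ∨ b
a ⇔ᵇ b = (a ⇒ᵇ b) ∧ (b ⇒ᵇ a)

holdsᵇ : Formula k → Vec Bool k → Bool
holdsᵇ (s ⊑ t) β = bit s β ⇒ᵇ bit t β
holdsᵇ (s ≐ t) β = bit s β ⇔ᵇ bit t β

sequentᵇ : Sequent k → Vec Bool k → Bool
sequentᵇ (⊢ g)    β = holdsᵇ g β
sequentᵇ (h ,, s) β = holdsᵇ h β ⇒ᵇ sequentᵇ s β

-- A `Subset k` is a vector of Booleans, so `allSubsets k` also enumerates the truth assignments to
-- `k` set variables.
valid : Sequent k → Bool
valid {k} s = all (sequentᵇ s) (allSubsets k)

∈-allSubsets : (A : Subset n) → A ∈ₗ allSubsets n
∈-allSubsets []            = here refl
∈-allSubsets (outside ∷ A) = ∈-++⁺ˡ (∈-map⁺ (outside ∷_) (∈-allSubsets A))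
∈-allSubsets {suc n} (inside ∷ A) =
  ∈-++⁺ʳ (map (outside ∷_) (allSubsets n)) (∈-map⁺ (inside ∷_) (∈-allSubsets A))

all-∈ : ∀ {A : Set} (p : A → Bool) {xs x} → T (all p xs) → x ∈ₗ xs → p x ≡ true
all-∈ p {y ∷ ys} h i with p y in eq
all-∈ p h (here refl) | true = eq
all-∈ p h (there i)   | true = all-∈ p h i

column : Vec (Subset n) k → Fin n → Vec Bool k
column ρ x = Vec.map (λ A → lookup A x) ρ

lookup-─ : (A B : Subset n) (x : Fin n) → lookup (A ─ B) x ≡ lookup A x ∧ not (lookup B x)
lookup-─ (a ∷ A)       (b ∷ B) (suc x) = lookup-─ A B x
lookup-─ (outside ∷ A) (outside ∷ B) zero = refl
lookup-─ (outside ∷ A) (inside ∷ B)  zero = refl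
lookup-─ (inside ∷ A)  (outside ∷ B) zero = refl
lookup-─ (inside ∷ A)  (inside ∷ B)  zero = refl

lookup-⟦⟧ : (t : Term k) (ρ : Vec (Subset n) k) (x : Fin n) →
            lookup (⟦ t ⟧ ρ) x ≡ bit t (column ρ x)
lookup-⟦⟧ (var i)  ρ x = sym (lookup-map i (λ A → lookup A x) ρ)
lookup-⟦⟧ ∅ᵗ       ρ x = lookup-replicate x outside
lookup-⟦⟧ (s ∪ᵗ t) ρ x = trans (lookup-zipWith _∨_ x (⟦ s ⟧ ρ) (⟦ t ⟧ ρ))
                               (cong₂ _∨_ (lookup-⟦⟧ s ρ x) (lookup-⟦⟧ t ρ x))
lookup-⟦⟧ (s ∩ᵗ t) ρ x = trans (lookup-zipWith _∧_ x (⟦ s ⟧ ρ) (⟦ t ⟧ ρ))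
                               (cong₂ _∧_ (lookup-⟦⟧ s ρ x) (lookup-⟦⟧ t ρ x))
lookup-⟦⟧ (s ─ᵗ t) ρ x = trans (lookup-─ (⟦ s ⟧ ρ) (⟦ t ⟧ ρ) x)
                               (cong₂ (λ a b → a ∧ not b) (lookup-⟦⟧ s ρ x) (lookup-⟦⟧ t ρ x))

⇒ᵇ-elim : ∀ {a b} → (a ⇒ᵇ b) ≡ true → a ≡ true → b ≡ true
⇒ᵇ-elim h refl = h

⇒ᵇ-intro : ∀ {a b} → (a ≡ true → b ≡ true) → (a ⇒ᵇ b) ≡ true
⇒ᵇ-intro {false} f = refl
⇒ᵇ-intro {true}  f = f refl

∧-true : ∀ {a b} → (a ∧ b) ≡ true → a ≡ true × b ≡ true
∧-true {true} {true} _ = refl , refl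

T⇒true : ∀ {b} → T b → b ≡ true
T⇒true {true} _ = refl

true-∧ : ∀ {a b} → a ≡ true → b ≡ true → (a ∧ b) ≡ true
true-∧ refl refl = refl

⇔⇒≡ : ∀ {a b : Bool} → (a ≡ true → b ≡ true) → (b ≡ true → a ≡ true) → a ≡ b
⇔⇒≡ {false} {false} f g = refl
⇔⇒≡ {false} {true}  f g = g refl
⇔⇒≡ {true}  {b}     f g = sym (f refl)

∈⇒bit : (t : Term k) (ρ : Vec (Subset n) k) {x : Fin n} → x ∈ ⟦ t ⟧ ρ → bit t (column ρ x) ≡ true
∈⇒bit t ρ i = trans (sym (lookup-⟦⟧ t ρ _)) ([]=⇒lookup i)

bit⇒∈ : (t : Term k) (ρ : Vec (Subset n) k) {x : Fin n} → bit t (column ρ x) ≡ true → x ∈ ⟦ t ⟧ ρ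
bit⇒∈ t ρ e = lookup⇒[]= _ (⟦ t ⟧ ρ) (trans (lookup-⟦⟧ t ρ _) e)

⊆⇒ᵇ : (s t : Term k) (ρ : Vec (Subset n) k) → ⟦ s ⟧ ρ ⊆ ⟦ t ⟧ ρ → ∀ x →
      (bit s (column ρ x) ⇒ᵇ bit t (column ρ x)) ≡ true
⊆⇒ᵇ s t ρ h x = ⇒ᵇ-intro (λ e → ∈⇒bit t ρ (h (bit⇒∈ s ρ e)))

holds⇒holdsᵇ : (f : Formula k) (ρ : Vec (Subset n) k) → Holds f ρ → ∀ x →
               holdsᵇ f (column ρ x) ≡ true
holds⇒holdsᵇ (s ⊑ t) ρ h x = ⊆⇒ᵇ s t ρ h x
holds⇒holdsᵇ (s ≐ t) ρ h x =
  true-∧ (⊆⇒ᵇ s t ρ (⊆-reflexive h) x) (⊆⇒ᵇ t s ρ (⊆-reflexive (sym h)) x)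

holdsᵇ⇒holds : (f : Formula k) (ρ : Vec (Subset n) k) →
               (∀ x → holdsᵇ f (column ρ x) ≡ true) → Holds f ρ
holdsᵇ⇒holds (s ⊑ t) ρ h i = bit⇒∈ t ρ (⇒ᵇ-elim (h _) (∈⇒bit s ρ i))
holdsᵇ⇒holds (s ≐ t) ρ h = ⊆-antisym
  (λ i → bit⇒∈ t ρ (⇒ᵇ-elim (proj₁ (∧-true (h _))) (∈⇒bit s ρ i)))
  (λ i → bit⇒∈ s ρ (⇒ᵇ-elim (proj₂ (∧-true (h _))) (∈⇒bit t ρ i)))

sequent-sound : (s : Sequent k) (ρ : Vec (Subset n) k) →
                (∀ x → sequentᵇ s (column ρ x) ≡ true) → Meaning s ρ
sequent-sound (⊢ g)    ρ h = holdsᵇ⇒holds g ρ h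
sequent-sound (f ,, s) ρ h hf =
  sequent-sound s ρ (λ x → ⇒ᵇ-elim (h x) (holds⇒holdsᵇ f ρ hf x))

abstract
  -- Inclusions and equations of sets hold pointwise, and a point enters only through its column of
  -- memberships, so checking all columns suffices. For a concrete sequent `T (valid s)` computes to
  -- the unit type and is filled in silently; `abstract` keeps the proof term from unfolding.
  sets : (s : Sequent k) (ρ : Vec (Subset n) k) {_ : T (valid s)} → Meaning s ρ
  sets s ρ {v} = sequent-sound s ρ (λ x → all-∈ (sequentᵇ s) v (∈-allSubsets _))

∈⇒⁅⁆⊆ : ∀ {x} {A : Subset n} → x ∈ A → ⁅ x ⁆ ⊆ A
∈⇒⁅⁆⊆ {x = x} i j = subst (_∈ _) (sym (x∈⁅y⁆⇒x≡y x j)) i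

∉⇒⁅⁆∩⊆∅ : ∀ {x} {A : Subset n} → x ∉ A → ⁅ x ⁆ ∩ A ⊆ ∅
∉⇒⁅⁆∩⊆∅ {x = x} {A} h i with x∈p∩q⁻ ⁅ x ⁆ A i
... | j , l = contradiction (subst (_∈ A) (x∈⁅y⁆⇒x≡y x j) l) h

⁅⁆∩⊆∅⇒∉ : ∀ {x} {A : Subset n} → ⁅ x ⁆ ∩ A ⊆ ∅ → x ∉ A
⁅⁆∩⊆∅⇒∉ {x = x} h i = ∉⊥ (h (x∈p∩q⁺ (x∈⁅x⁆ x , i)))

Empty⇒⊆∅ : {A : Subset n} → Empty A → A ⊆ ∅
Empty⇒⊆∅ h i = contradiction (_ , i) h

⊆∅⇒Empty : {A : Subset n} → A ⊆ ∅ → Empty A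
⊆∅⇒Empty h (x , i) = ∉⊥ (h i)

-- Cardinalities

∣∪∣+∣∩∣ : (A B : Subset n) → ∣ A ∪ B ∣ + ∣ A ∩ B ∣ ≡ ∣ A ∣ + ∣ B ∣
∣∪∣+∣∩∣ [] [] = refl
∣∪∣+∣∩∣ (outside ∷ A) (outside ∷ B) = ∣∪∣+∣∩∣ A B
∣∪∣+∣∩∣ (outside ∷ A) (inside ∷ B)  = trans (cong suc (∣∪∣+∣∩∣ A B)) (sym (+-suc ∣ A ∣ ∣ B ∣))
∣∪∣+∣∩∣ (inside ∷ A)  (outside ∷ B) = cong suc (∣∪∣+∣∩∣ A B)
∣∪∣+∣∩∣ (inside ∷ A)  (inside ∷ B)  =
  cong suc (trans (+-suc ∣ A ∪ B ∣ _) (trans (cong suc (∣∪∣+∣∩∣ A B)) (sym (+-suc ∣ A ∣ ∣ B ∣))))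

⊆∅⇒≡∅ : {A : Subset n} → A ⊆ ∅ → A ≡ ∅
⊆∅⇒≡∅ h = ⊆-antisym h ⊥⊆

∣∅∣≡0 : {A : Subset n} → A ⊆ ∅ → ∣ A ∣ ≡ 0
∣∅∣≡0 {n} h = trans (cong ∣_∣ (⊆∅⇒≡∅ h)) (∣⊥∣≡0 n)

∣∪∣-disjoint : {A B : Subset n} → A ∩ B ⊆ ∅ → ∣ A ∪ B ∣ ≡ ∣ A ∣ + ∣ B ∣
∣∪∣-disjoint {A = A} {B} h =
  trans (sym (trans (cong (∣ A ∪ B ∣ +_) (∣∅∣≡0 h)) (+-identityʳ _))) (∣∪∣+∣∩∣ A B)

∣∪⁅⁆∣ : ∀ {x} {A : Subset n} → x ∉ A → ∣ A ∪ ⁅ x ⁆ ∣ ≡ suc ∣ A ∣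
∣∪⁅⁆∣ {x = x} {A} h =
  trans (∣∪∣-disjoint (sets (#1 ∩ᵗ #0 ⊑ ∅ᵗ ⊢ #0 ∩ᵗ #1 ⊑ ∅ᵗ) (A ∷ ⁅ x ⁆ ∷ []) (∉⇒⁅⁆∩⊆∅ h)))
        (trans (cong (∣ A ∣ +_) (∣⁅x⁆∣≡1 x)) (+-comm ∣ A ∣ 1))

∣∣-split : (A B : Subset n) → ∣ A ∣ ≡ ∣ A ∩ B ∣ + ∣ A ─ B ∣
∣∣-split A B = trans (cong ∣_∣ (sets (⊢ #0 ≐ (#0 ∩ᵗ #1) ∪ᵗ (#0 ─ᵗ #1)) (A ∷ B ∷ [])))
  (∣∪∣-disjoint (sets (⊢ (#0 ∩ᵗ #1) ∩ᵗ (#0 ─ᵗ #1) ⊑ ∅ᵗ) (A ∷ B ∷ [])))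

⊆∧∣≥∣⇒≡ : {A B : Subset n} → A ⊆ B → ∣ B ∣ ≤ ∣ A ∣ → A ≡ B
⊆∧∣≥∣⇒≡ {A = A} {B} h c = ⊆-antisym h λ {x} i → case x ∈? A of λ where
  (yes j) → j
  (no ¬j) → contradiction (p⊂q⇒∣p∣<∣q∣ (h , x , i , ¬j)) (≤⇒≯ c)

⊈⇒∃ : {A B : Subset n} → ¬ A ⊆ B → ∃ λ x → x ∈ A × x ∉ B
⊈⇒∃ {A = A} {B} h with nonempty? (A ─ B)
... | yes (x , i) = x , p─q⊆p A B i , ⁅⁆∩⊆∅⇒∉ (sets (#2 ⊑ #0 ─ᵗ #1 ⊢ #2 ∩ᵗ #1 ⊑ ∅ᵗ) (A ∷ B ∷ ⁅ x ⁆ ∷ []) (∈⇒⁅⁆⊆ i))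
... | no ¬i = ⊥-elim (h (sets (#0 ─ᵗ #1 ⊑ ∅ᵗ ⊢ #0 ⊑ #1) (A ∷ B ∷ []) (Empty⇒⊆∅ ¬i)))

-- Rank

foldr-max-≥ : (p : Subset n → Bool) {I : Subset n} {Bs : List (Subset n)} →
  p I ≡ true → I ∈ₗ Bs → ∣ I ∣ ≤ foldr (λ B r → if p B then ∣ B ∣ ⊔ r else r) 0 Bs
foldr-max-≥ p {I} h (here refl) rewrite h = m≤m⊔n ∣ I ∣ _
foldr-max-≥ p {I} {B ∷ Bs} h (there i) with p B
... | true  = m≤n⇒m≤o⊔n ∣ B ∣ (foldr-max-≥ p h i)
... | false = foldr-max-≥ p h i

-- The fold is the one that `rank` unfolds to. Its initial value 0 must itself be the size of an
-- admissible set; `I₀` is that set, and later it is `∅`.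
foldr-max-attained : (p : Subset n → Bool) {I₀ : Subset n} → p I₀ ≡ true → ∣ I₀ ∣ ≡ 0 →
  (Bs : List (Subset n)) →
  ∃ λ I → p I ≡ true × ∣ I ∣ ≡ foldr (λ B r → if p B then ∣ B ∣ ⊔ r else r) 0 Bs
foldr-max-attained p h z [] = _ , h , z
foldr-max-attained p h z (B ∷ Bs) with p B in eq | foldr-max-attained p h z Bs
... | false | w = w
... | true  | I , pI , e with ≤-total ∣ B ∣ (foldr (λ B r → if p B then ∣ B ∣ ⊔ r else r) 0 Bs)
...   | inj₁ le = I , pI , trans e (sym (m≤n⇒m⊔n≡n le))
...   | inj₂ ge = B , eq , sym (m≥n⇒m⊔n≡m ge)

⌊⌋-true : ∀ {P : Set} (d : Dec P) → P → ⌊ d ⌋ ≡ true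
⌊⌋-true (yes _) _ = refl
⌊⌋-true (no ¬p) p = contradiction p ¬p

true-⌊⌋ : ∀ {P : Set} (d : Dec P) → ⌊ d ⌋ ≡ true → P
true-⌊⌋ (yes p) _ = p

rank-≥ : (M : RawMatroid n) {I A : Subset n} → I ⊆ A → Indep M I → ∣ I ∣ ≤ rank M A
rank-≥ M {I} {A} h i =
  foldr-max-≥ (λ B → ⌊ B ⊆? A ⌋ ∧ indep M B) (true-∧ (⌊⌋-true (I ⊆? A) h) i) (∈-allSubsets I)

rank-attained : (M : RawMatroid n) → Indep M ∅ → (A : Subset n) →
                ∃ λ I → I ⊆ A × Indep M I × ∣ I ∣ ≡ rank M A
rank-attained {n} M i∅ A
  with foldr-max-attained (λ B → ⌊ B ⊆? A ⌋ ∧ indep M B)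
         (true-∧ (⌊⌋-true (∅ ⊆? A) ⊥⊆) i∅) (∣⊥∣≡0 n) (allSubsets n)
... | I , pI , e with ∧-true pI
...   | s , i = I , true-⌊⌋ (I ⊆? A) s , i , e

rank-cong : (M N : RawMatroid n) → (∀ A → indep M A ≡ indep N A) → ∀ A → rank M A ≡ rank N A
rank-cong {n} M N e A =
  foldr-cong (λ B r → cong (λ b → if ⌊ B ⊆? A ⌋ ∧ b then ∣ B ∣ ⊔ r else r) (e B)) refl (allSubsets n)

rank-mono : (M : RawMatroid n) → Indep M ∅ → {A B : Subset n} → A ⊆ B → rank M A ≤ rank M B
rank-mono M i∅ {A} {B} h with rank-attained M i∅ A
... | I , s , i , e = subst (_≤ _) e (rank-≥ M (⊆-trans s h) i)

rank≤∣∣ : (M : RawMatroid n) → Indep M ∅ → (A : Subset n) → rank M A ≤ ∣ A ∣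
rank≤∣∣ M i∅ A with rank-attained M i∅ A
... | I , s , i , e = subst (_≤ _) e (p⊆q⇒∣p∣≤∣q∣ s)

∣∣≤rank⇒Indep : (M : RawMatroid n) → Indep M ∅ → {A : Subset n} → ∣ A ∣ ≤ rank M A → Indep M A
∣∣≤rank⇒Indep M i∅ {A} h with rank-attained M i∅ A
... | I , s , i , e = subst (Indep M) (⊆∧∣≥∣⇒≡ s (≤-trans h (≤-reflexive (sym e)))) i

-- Rank in a matroid: submodularity, spanning and contraction

module MatroidRank {n : ℕ} (M : RawMatroid n) (isM : IsMatroid M) where
  open IsMatroid isM

  r : Subset n → ℕ
  r = rank M

  r-mono : {A B : Subset n} → A ⊆ B → r A ≤ r B
  r-mono = rank-mono M indep-∅

  r≤∣∣ : (A : Subset n) → r A ≤ ∣ A ∣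
  r≤∣∣ = rank≤∣∣ M indep-∅

  Indep⇒∣∣≤r : {I A : Subset n} → I ⊆ A → Indep M I → ∣ I ∣ ≤ r A
  Indep⇒∣∣≤r = rank-≥ M

  ∣∣≤r⇒Indep : {A : Subset n} → ∣ A ∣ ≤ r A → Indep M A
  ∣∣≤r⇒Indep = ∣∣≤rank⇒Indep M indep-∅

  ¬Indep⇒r<∣∣ : {A : Subset n} → ¬ Indep M A → r A < ∣ A ∣
  ¬Indep⇒r<∣∣ h = ≰⇒> (λ c → h (∣∣≤r⇒Indep c))

  -- As long as `I` is smaller than `r A`, augmentation against a largest independent subset of `A`
  -- supplies a new element of `A`. The number `d` bounds how many are still missing and makes the
  -- recursion structural.
  extend : ∀ d {I A} → r A ≤ d + ∣ I ∣ → I ⊆ A → Indep M I →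
           ∃ λ K → I ⊆ K × K ⊆ A × Indep M K × ∣ K ∣ ≡ r A
  extend zero {I} le s i = I , ⊆-refl , s , i , ≤-antisym (Indep⇒∣∣≤r s i) le
  extend (suc d) {I} {A} le s i with ∣ I ∣ <? r A
  ... | no ≮ = I , ⊆-refl , s , i , ≤-antisym (Indep⇒∣∣≤r s i) (≮⇒≥ ≮)
  ... | yes lt with rank-attained M indep-∅ A
  ...   | L , L⊆A , iL , eL with augment I L i iL (subst (∣ I ∣ <_) (sym eL) lt)
  ...     | x , x∈L , x∉I , ix
          with extend d {I ∪ ⁅ x ⁆} {A}
                 (≤-trans le (≤-reflexive (trans (sym (+-suc d ∣ I ∣)) (cong (d +_) (sym (∣∪⁅⁆∣ x∉I))))))
                 (sets (#0 ⊑ #1 ,, #2 ⊑ #1 ⊢ #0 ∪ᵗ #2 ⊑ #1) (I ∷ A ∷ ⁅ x ⁆ ∷ []) s (∈⇒⁅⁆⊆ (L⊆A x∈L))) ix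
  ...       | K , s₁ , s₂ , iK , eK = K , ⊆-trans (p⊆p∪q ⁅ x ⁆) s₁ , s₂ , iK , eK

  basis⊇ : ∀ {I A} → I ⊆ A → Indep M I → ∃ λ K → I ⊆ K × K ⊆ A × Indep M K × ∣ K ∣ ≡ r A
  basis⊇ {I} {A} = extend (r A) (m≤m+n (r A) ∣ I ∣)

  basis : ∀ A → ∃ λ K → K ⊆ A × Indep M K × ∣ K ∣ ≡ r A
  basis A = rank-attained M indep-∅ A

  -- Extend a basis `J` of `A ∩ B` to a basis `K` of `A ∪ B`. Then `K` is covered by its traces on
  -- `A` and `B`, whose intersection contains `J`, and each trace is independent.
  submodular : ∀ A B → r (A ∪ B) + r (A ∩ B) ≤ r A + r B
  submodular A B with basis (A ∩ B)
  ... | J , J⊆ , iJ , eJ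
    with basis⊇ {J} {A ∪ B} (sets (#0 ⊑ #1 ∩ᵗ #2 ⊢ #0 ⊑ #1 ∪ᵗ #2) (J ∷ A ∷ B ∷ []) J⊆) iJ
  ...   | K , J⊆K , K⊆ , iK , eK = begin
    r (A ∪ B) + r (A ∩ B)                     ≡⟨ cong₂ _+_ (sym eK) (sym eJ) ⟩
    ∣ K ∣ + ∣ J ∣                             ≤⟨ +-mono-≤ (p⊆q⇒∣p∣≤∣q∣ (sets (#0 ⊑ #1 ∪ᵗ #2 ⊢ #0 ⊑ #0 ∩ᵗ #1 ∪ᵗ #0 ∩ᵗ #2) (K ∷ A ∷ B ∷ []) K⊆))
                                                  (p⊆q⇒∣p∣≤∣q∣ (sets (#0 ⊑ #2 ∩ᵗ #3 ,, #0 ⊑ #1 ⊢ #0 ⊑ (#1 ∩ᵗ #2) ∩ᵗ (#1 ∩ᵗ #3)) (J ∷ K ∷ A ∷ B ∷ []) J⊆ J⊆K)) ⟩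
    ∣ K ∩ A ∪ K ∩ B ∣ + ∣ (K ∩ A) ∩ (K ∩ B) ∣ ≡⟨ ∣∪∣+∣∩∣ (K ∩ A) (K ∩ B) ⟩
    ∣ K ∩ A ∣ + ∣ K ∩ B ∣                     ≤⟨ +-mono-≤ (Indep⇒∣∣≤r (p∩q⊆q K A) (hereditary _ _ (p∩q⊆p K A) iK))
                                                          (Indep⇒∣∣≤r (p∩q⊆q K B) (hereditary _ _ (p∩q⊆p K B) iK)) ⟩
    r A + r B                                 ∎
    where open ≤-Reasoning

  r-∪≤ : ∀ A B → r (A ∪ B) ≤ r A + ∣ B ∣
  r-∪≤ A B = ≤-trans (m≤m+n _ _) (≤-trans (submodular A B) (+-monoʳ-≤ (r A) (r≤∣∣ B)))

  -- Spanning survives the addition of `Z`: submodularity is applied to `Y` and `X ∪ Z`, whose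
  -- intersection contains `X`. This takes the place of monotonicity of closure.
  spanning-∪ : ∀ {X Y} → X ⊆ Y → r Y ≤ r X → ∀ Z → r (Y ∪ Z) ≤ r (X ∪ Z)
  spanning-∪ {X} {Y} s le Z = +-cancelʳ-≤ (r X) _ _ (begin
    r (Y ∪ Z) + r X                   ≤⟨ +-mono-≤ (r-mono (sets (#0 ⊑ #1 ⊢ #1 ∪ᵗ #2 ⊑ #1 ∪ᵗ (#0 ∪ᵗ #2)) (X ∷ Y ∷ Z ∷ []) s))
                                                  (r-mono (sets (#0 ⊑ #1 ⊢ #0 ⊑ #1 ∩ᵗ (#0 ∪ᵗ #2)) (X ∷ Y ∷ Z ∷ []) s)) ⟩
    r (Y ∪ (X ∪ Z)) + r (Y ∩ (X ∪ Z)) ≤⟨ submodular Y (X ∪ Z) ⟩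
    r Y + r (X ∪ Z)                   ≤⟨ +-monoˡ-≤ _ le ⟩
    r X + r (X ∪ Z)                   ≡⟨ +-comm (r X) _ ⟩
    r (X ∪ Z) + r X                   ∎)
    where open ≤-Reasoning

  -- A basis of `X` is augmented from one of `X ∪ Y`. The element found raises the rank of `X`, so
  -- it cannot lie in `X` and must come from `Y`.
  r-augment : ∀ X Y → r X < r (X ∪ Y) → ∃ λ x → x ∈ Y × r X < r (X ∪ ⁅ x ⁆)
  r-augment X Y lt with basis X | basis (X ∪ Y)
  ... | K , K⊆ , iK , eK | L , L⊆ , iL , eL with augment K L iK iL (subst₂ _<_ (sym eK) (sym eL) lt)
  ...   | x , x∈L , x∉K , ix = x , x∈Y , big
    where
    big : r X < r (X ∪ ⁅ x ⁆)
    big = ≤-trans (≤-reflexive (trans (cong suc (sym eK)) (sym (∣∪⁅⁆∣ x∉K))))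
            (Indep⇒∣∣≤r (sets (#0 ⊑ #1 ⊢ #0 ∪ᵗ #2 ⊑ #1 ∪ᵗ #2) (K ∷ X ∷ ⁅ x ⁆ ∷ []) K⊆) ix)
    x∈Y : x ∈ Y
    x∈Y with x∈p∪q⁻ X Y (L⊆ x∈L)
    ... | inj₂ j = j
    ... | inj₁ j = contradiction big (≤⇒≯ (r-mono (sets (#0 ⊑ #1 ⊢ #1 ∪ᵗ #0 ⊑ #1) (⁅ x ⁆ ∷ X ∷ []) (∈⇒⁅⁆⊆ j))))

  -- Independence in the contraction M/A, for sets disjoint from A.
  IndepOver : Subset n → Subset n → Set
  IndepOver A I = ∣ I ∣ + r A ≤ r (I ∪ A)

  -- This bound always holds, so the inequality `IndepOver` is equivalent to the equality that
  -- defines `minor`.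
  r-∪≤′ : ∀ I A → r (I ∪ A) ≤ ∣ I ∣ + r A
  r-∪≤′ I A = subst₂ _≤_ (cong r (∪-comm A I)) (+-comm (r A) ∣ I ∣) (r-∪≤ A I)

  -- Adding `J ─ I` raises the rank by at most its size, so a rank deficit of `I` over `A` would
  -- persist in `J`.
  IndepOver-⊆ : ∀ {A I J} → I ⊆ J → IndepOver A J → IndepOver A I
  IndepOver-⊆ {A} {I} {J} s h = +-cancelˡ-≤ ∣ J ─ I ∣ _ _ (begin
    ∣ J ─ I ∣ + (∣ I ∣ + r A)      ≡⟨ sym (+-assoc ∣ J ─ I ∣ _ _) ⟩
    (∣ J ─ I ∣ + ∣ I ∣) + r A      ≡⟨ cong (_+ r A) (+-comm ∣ J ─ I ∣ _) ⟩
    (∣ I ∣ + ∣ J ─ I ∣) + r A      ≡⟨ cong (λ B → (∣ B ∣ + ∣ J ─ I ∣) + r A) (sets (#0 ⊑ #1 ⊢ #0 ≐ #1 ∩ᵗ #0) (I ∷ J ∷ []) s) ⟩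
    (∣ J ∩ I ∣ + ∣ J ─ I ∣) + r A  ≡⟨ cong (_+ r A) (sym (∣∣-split J I)) ⟩
    ∣ J ∣ + r A                    ≤⟨ h ⟩
    r (J ∪ A)                      ≤⟨ r-mono (sets (⊢ #1 ∪ᵗ #2 ⊑ (#1 ─ᵗ #0) ∪ᵗ (#0 ∪ᵗ #2)) (I ∷ J ∷ A ∷ [])) ⟩
    r ((J ─ I) ∪ (I ∪ A))          ≤⟨ r-∪≤′ (J ─ I) (I ∪ A) ⟩
    ∣ J ─ I ∣ + r (I ∪ A)          ∎)
    where open ≤-Reasoning

  -- Extend a basis of `A` to a basis `K` of `Z ∪ A` and remove `A`. Since `K ∩ A` still has at
  -- least `r A` elements, nothing is lost in the count over `A`.
  basisOver : ∀ A Z → ∃ λ J → J ⊆ Z ─ A × IndepOver A J × r (Z ∪ A) ≤ r (J ∪ A)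
  basisOver A Z with basis A
  ... | K₀ , K₀⊆A , iK₀ , eK₀
    with basis⊇ {K₀} {Z ∪ A} (sets (#0 ⊑ #1 ⊢ #0 ⊑ #2 ∪ᵗ #1) (K₀ ∷ A ∷ Z ∷ []) K₀⊆A) iK₀
  ...   | K , K₀⊆K , K⊆ , iK , eK =
      K ─ A , sets (#0 ⊑ #2 ∪ᵗ #1 ⊢ #0 ─ᵗ #1 ⊑ #2 ─ᵗ #1) (K ∷ A ∷ Z ∷ []) K⊆ , indepOver ,
      ≤-trans (≤-reflexive (sym eK)) K≤
    where
    open ≤-Reasoning
    K≤ : ∣ K ∣ ≤ r ((K ─ A) ∪ A)
    K≤ = Indep⇒∣∣≤r (sets (⊢ #0 ⊑ (#0 ─ᵗ #1) ∪ᵗ #1) (K ∷ A ∷ [])) iK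
    indepOver : IndepOver A (K ─ A)
    indepOver = begin
      ∣ K ─ A ∣ + r A         ≡⟨ +-comm ∣ K ─ A ∣ _ ⟩
      r A + ∣ K ─ A ∣         ≡⟨ cong (_+ ∣ K ─ A ∣) (sym eK₀) ⟩
      ∣ K₀ ∣ + ∣ K ─ A ∣      ≤⟨ +-monoˡ-≤ _ (p⊆q⇒∣p∣≤∣q∣ (sets (#0 ⊑ #1 ,, #0 ⊑ #2 ⊢ #0 ⊑ #2 ∩ᵗ #1) (K₀ ∷ A ∷ K ∷ []) K₀⊆A K₀⊆K)) ⟩
      ∣ K ∩ A ∣ + ∣ K ─ A ∣   ≡⟨ sym (∣∣-split K A) ⟩
      ∣ K ∣                   ≤⟨ K≤ ⟩
      r ((K ─ A) ∪ A)         ∎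

-- Minors and their rank

module Minors {n : ℕ} (M : RawMatroid n) (isM : IsMatroid M) where
  open MatroidRank M isM

  minor⇒ : ∀ A B I → Indep (minor M A B) I → I ⊆ B ─ A × IndepOver A I
  minor⇒ A B I h with ∧-true h
  ... | s , e = true-⌊⌋ (I ⊆? (B ─ A)) s ,
                ≤-reflexive (sym (≡ᵇ⇒≡ (r (I ∪ A)) _ (subst T (sym e) tt)))

  minor⇐ : ∀ A B I → I ⊆ B ─ A → IndepOver A I → Indep (minor M A B) I
  minor⇐ A B I s h =
    true-∧ (⌊⌋-true (I ⊆? (B ─ A)) s)
           (T⇒true (≡⇒≡ᵇ (r (I ∪ A)) _ (≤-antisym (r-∪≤′ I A) h)))

  minor-∅ : ∀ A B → Indep (minor M A B) ∅
  minor-∅ A B = minor⇐ A B ∅ ⊥⊆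
    (≤-trans (≤-reflexive (cong (_+ r A) (∣⊥∣≡0 n))) (r-mono (q⊆p∪q ∅ A)))

  -- Only augmentation has content. A larger `J` independent over `A` makes `r (J ∪ A)` exceed
  -- `r (I ∪ A)`, so `r-augment` yields an element of `J` that raises the rank over `I ∪ A`.
  minor-isMatroid : ∀ A B → IsMatroid (minor M A B)
  minor-isMatroid A B = record
    { indep⊆ground = λ I h → proj₁ (minor⇒ A B I h)
    ; indep-∅      = minor-∅ A B
    ; hereditary   = λ I J s h → let (J⊆ , iJ) = minor⇒ A B J h in
                       minor⇐ A B I (⊆-trans s J⊆) (IndepOver-⊆ s iJ)
    ; augment      = λ I J hI hJ lt → aug I J (minor⇒ A B I hI) (minor⇒ A B J hJ) lt
    }
    where
    aug : ∀ I J → I ⊆ B ─ A × IndepOver A I → J ⊆ B ─ A × IndepOver A J → ∣ I ∣ < ∣ J ∣ →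
          ∃ λ x → x ∈ J × x ∉ I × Indep (minor M A B) (I ∪ ⁅ x ⁆)
    aug I J (I⊆ , iI) (J⊆ , iJ) lt = enlarge (r-augment (I ∪ A) J (begin-strict
        r (I ∪ A)       ≤⟨ r-∪≤′ I A ⟩
        ∣ I ∣ + r A     <⟨ +-monoˡ-< (r A) lt ⟩
        ∣ J ∣ + r A     ≤⟨ iJ ⟩
        r (J ∪ A)       ≤⟨ r-mono (sets (⊢ #1 ∪ᵗ #2 ⊑ (#0 ∪ᵗ #2) ∪ᵗ #1) (I ∷ J ∷ A ∷ [])) ⟩
        r ((I ∪ A) ∪ J) ∎))
      where
      open ≤-Reasoning
      enlarge : (∃ λ x → x ∈ J × r (I ∪ A) < r ((I ∪ A) ∪ ⁅ x ⁆)) →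
                ∃ λ x → x ∈ J × x ∉ I × Indep (minor M A B) (I ∪ ⁅ x ⁆)
      enlarge (x , x∈J , big) = x , x∈J , x∉I ,
        minor⇐ A B (I ∪ ⁅ x ⁆) (sets (#0 ⊑ #1 ,, #2 ⊑ #3 ,, #3 ⊑ #1 ⊢ #0 ∪ᵗ #2 ⊑ #1) (I ∷ (B ─ A) ∷ ⁅ x ⁆ ∷ J ∷ []) I⊆ (∈⇒⁅⁆⊆ x∈J) J⊆)
          (begin
            ∣ I ∪ ⁅ x ⁆ ∣ + r A   ≡⟨ cong (_+ r A) (∣∪⁅⁆∣ x∉I) ⟩
            suc (∣ I ∣ + r A)     ≤⟨ s≤s iI ⟩
            suc (r (I ∪ A))       ≤⟨ big ⟩
            r ((I ∪ A) ∪ ⁅ x ⁆)   ≤⟨ r-mono (sets (⊢ (#0 ∪ᵗ #1) ∪ᵗ #2 ⊑ (#0 ∪ᵗ #2) ∪ᵗ #1) (I ∷ A ∷ ⁅ x ⁆ ∷ [])) ⟩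
            r ((I ∪ ⁅ x ⁆) ∪ A)   ∎)
        where
        x∉I : x ∉ I
        x∉I x∈I = <⇒≱ big (r-mono (sets (#2 ⊑ #0 ⊢ (#0 ∪ᵗ #1) ∪ᵗ #2 ⊑ #0 ∪ᵗ #1) (I ∷ A ∷ ⁅ x ⁆ ∷ []) (∈⇒⁅⁆⊆ x∈I)))

  rank-minor : ∀ {A B Z} → Z ⊆ B ─ A → rank (minor M A B) Z + r A ≡ r (Z ∪ A)
  rank-minor {A} {B} {Z} s = ≤-antisym upper lower
    where
    open ≤-Reasoning
    N = minor M A B
    upper : rank N Z + r A ≤ r (Z ∪ A)
    upper = let (J , J⊆Z , iJ , e) = rank-attained N (minor-∅ A B) Z in begin
      rank N Z + r A ≡⟨ cong (_+ r A) (sym e) ⟩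
      ∣ J ∣ + r A    ≤⟨ proj₂ (minor⇒ A B J iJ) ⟩
      r (J ∪ A)      ≤⟨ r-mono (sets (#0 ⊑ #1 ⊢ #0 ∪ᵗ #2 ⊑ #1 ∪ᵗ #2) (J ∷ Z ∷ A ∷ []) J⊆Z) ⟩
      r (Z ∪ A)      ∎
    lower : r (Z ∪ A) ≤ rank N Z + r A
    lower = let (J , J⊆ , iJ , le) = basisOver A Z
                J⊆Z = ⊆-trans J⊆ (p─q⊆p Z A) in begin
      r (Z ∪ A)      ≤⟨ le ⟩
      r (J ∪ A)      ≤⟨ r-∪≤′ J A ⟩
      ∣ J ∣ + r A    ≤⟨ +-monoˡ-≤ (r A) (rank-≥ N J⊆Z (minor⇐ A B J (⊆-trans J⊆Z s) iJ)) ⟩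
      rank N Z + r A ∎

-- Circuits, closures and cyclic flats

module CyclicFlats {n : ℕ} (M : RawMatroid n) (isM : IsMatroid M) where
  open IsMatroid isM
  open MatroidRank M isM

  -- The closure of `X`, built by adding elements that do not raise the rank. The bound `d` counts
  -- the ground elements left; at zero `X` is the whole ground set and no candidate exists.
  flat⊇ : ∀ d {X} → ∣ ground M ∣ ≤ d + ∣ X ∣ → X ⊆ ground M →
          ∃ λ F → X ⊆ F × r F ≤ r X × IsFlat M F
  flat⊇ d {X} le s
    with any? (λ x → (x ∈? ground M) ×-dec ¬? (x ∈? X) ×-dec (r (X ∪ ⁅ x ⁆) ≤? r X))
  ... | no none = X , ⊆-refl , ≤-refl , s , λ x g x∉X → ≰⇒> (λ c → none (x , g , x∉X , c))
  flat⊇ zero {X} le s | yes (x , g , x∉X , _) =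
    contradiction (subst (x ∈_) (sym (⊆∧∣≥∣⇒≡ s le)) g) x∉X
  flat⊇ (suc d) {X} le s | yes (x , g , x∉X , c)
    with flat⊇ d {X ∪ ⁅ x ⁆}
           (≤-trans le (≤-reflexive (trans (sym (+-suc d ∣ X ∣)) (cong (d +_) (sym (∣∪⁅⁆∣ x∉X))))))
           (sets (#0 ⊑ #1 ,, #2 ⊑ #1 ⊢ #0 ∪ᵗ #2 ⊑ #1) (X ∷ ground M ∷ ⁅ x ⁆ ∷ []) s (∈⇒⁅⁆⊆ g))
  ... | F , s′ , rF , flat = F , ⊆-trans (p⊆p∪q ⁅ x ⁆) s′ , ≤-trans rF c , flat

  -- Delete elements while dependence persists. When every single deletion is independent, heredity
  -- makes all proper subsets independent.
  circuit⊆ : ∀ d {D} → ∣ D ∣ ≤ d → D ⊆ ground M → ¬ Indep M D → ∃ λ C → C ⊆ D × IsCircuit M C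
  circuit⊆ d {D} le s dep with any? (λ x → (x ∈? D) ×-dec ¬? (indep M (D ─ ⁅ x ⁆) ≟ᵇ true))
  ... | no none = D , ⊆-refl , s , dep , λ D′ (D′⊆D , x , x∈D , x∉D′) →
          hereditary D′ (D ─ ⁅ x ⁆)
            (sets (#0 ⊑ #1 ,, #2 ∩ᵗ #0 ⊑ ∅ᵗ ⊢ #0 ⊑ #1 ─ᵗ #2) (D′ ∷ D ∷ ⁅ x ⁆ ∷ []) D′⊆D (∉⇒⁅⁆∩⊆∅ x∉D′))
            (decidable-stable (indep M (D ─ ⁅ x ⁆) ≟ᵇ true) (λ ¬i → none (x , x∈D , ¬i)))
  circuit⊆ zero {D} le s dep | yes (x , x∈D , dep′) =
    contradiction (≤-trans (x∈p⇒∣p-x∣<∣p∣ x∈D) le) λ ()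
  circuit⊆ (suc d) {D} le s dep | yes (x , x∈D , dep′)
    with circuit⊆ d {D ─ ⁅ x ⁆} (≤-pred (≤-trans (x∈p⇒∣p-x∣<∣p∣ x∈D) le)) (⊆-trans (p─q⊆p D ⁅ x ⁆) s) dep′
  ... | C , C⊆ , circ = C , ⊆-trans C⊆ (p─q⊆p D ⁅ x ⁆) , circ

  -- Adding `x` to a basis `J` of `F ─ ⁅ x ⁆` exceeds the rank of `F`, so a circuit appears; it must
  -- use `x` because `J` is independent.
  redundant⇒circuit : ∀ {F x} → F ⊆ ground M → x ∈ F → r F ≤ r (F ─ ⁅ x ⁆) →
                      ∃ λ C → IsCircuit M C × C ⊆ F × x ∈ C
  redundant⇒circuit {F} {x} s x∈F le with basis (F ─ ⁅ x ⁆)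
  ... | J , J⊆ , iJ , eJ with circuit⊆ ∣ J ∪ ⁅ x ⁆ ∣ ≤-refl (⊆-trans Jx⊆F s) dep
    where
    Jx⊆F : J ∪ ⁅ x ⁆ ⊆ F
    Jx⊆F = sets (#0 ⊑ #1 ─ᵗ #2 ,, #2 ⊑ #1 ⊢ #0 ∪ᵗ #2 ⊑ #1) (J ∷ F ∷ ⁅ x ⁆ ∷ []) J⊆ (∈⇒⁅⁆⊆ x∈F)
    x∉J : x ∉ J
    x∉J = ⁅⁆∩⊆∅⇒∉ (sets (#0 ⊑ #1 ─ᵗ #2 ⊢ #2 ∩ᵗ #0 ⊑ ∅ᵗ) (J ∷ F ∷ ⁅ x ⁆ ∷ []) J⊆)
    dep : ¬ Indep M (J ∪ ⁅ x ⁆)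
    dep i = <⇒≱ (≤-reflexive (trans (cong suc (sym eJ)) (sym (∣∪⁅⁆∣ x∉J))))
                (≤-trans (Indep⇒∣∣≤r Jx⊆F i) le)
  ...   | C , C⊆ , circ@(_ , depC , _) = C , circ , ⊆-trans C⊆
      (sets (#0 ⊑ #1 ─ᵗ #2 ,, #2 ⊑ #1 ⊢ #0 ∪ᵗ #2 ⊑ #1) (J ∷ F ∷ ⁅ x ⁆ ∷ []) J⊆ (∈⇒⁅⁆⊆ x∈F)) ,
      decidable-stable (x ∈? C) (λ x∉C → depC (hereditary C J
        (sets (#0 ⊑ #1 ∪ᵗ #2 ,, #2 ∩ᵗ #0 ⊑ ∅ᵗ ⊢ #0 ⊑ #1) (C ∷ J ∷ ⁅ x ⁆ ∷ []) C⊆ (∉⇒⁅⁆∩⊆∅ x∉C)) iJ))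

  circuit-redundant : ∀ {C x} → IsCircuit M C → x ∈ C → r C ≤ r (C ─ ⁅ x ⁆)
  circuit-redundant {C} {x} (_ , dep , proper) x∈C = ≤-pred (begin
    suc (r C)              ≤⟨ ¬Indep⇒r<∣∣ dep ⟩
    ∣ C ∣                  ≡⟨ cong ∣_∣ (sets (#1 ⊑ #0 ⊢ #0 ≐ (#0 ─ᵗ #1) ∪ᵗ #1) (C ∷ ⁅ x ⁆ ∷ []) (∈⇒⁅⁆⊆ x∈C)) ⟩
    ∣ (C ─ ⁅ x ⁆) ∪ ⁅ x ⁆ ∣ ≡⟨ ∣∪⁅⁆∣ (⁅⁆∩⊆∅⇒∉ (sets (⊢ #1 ∩ᵗ (#0 ─ᵗ #1) ⊑ ∅ᵗ) (C ∷ ⁅ x ⁆ ∷ []))) ⟩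
    suc ∣ C ─ ⁅ x ⁆ ∣      ≤⟨ s≤s (Indep⇒∣∣≤r ⊆-refl (proper (C ─ ⁅ x ⁆) (x∈p⇒p-x⊂p x∈C))) ⟩
    suc (r (C ─ ⁅ x ⁆))    ∎)
    where open ≤-Reasoning

  -- In the circuit through `x` the remaining elements span `x`, and `spanning-∪` carries this over
  -- to `F`. With `redundant⇒circuit` it turns cyclicity into a rank condition: deleting any one
  -- element keeps the rank.
  cyclic-redundant : ∀ {F x} → IsCyclic M F → x ∈ F → r F ≤ r (F ─ ⁅ x ⁆)
  cyclic-redundant {F} {x} cyc x∈F with cyc x x∈F
  ... | C , circ , C⊆F , x∈C = begin
    r F                             ≤⟨ r-mono (q⊆p∪q C F) ⟩
    r (C ∪ F)                       ≡⟨ cong r (sets (#2 ⊑ #0 ⊢ #0 ∪ᵗ #1 ≐ #0 ∪ᵗ (#1 ─ᵗ #2)) (C ∷ F ∷ ⁅ x ⁆ ∷ []) (∈⇒⁅⁆⊆ x∈C)) ⟩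
    r (C ∪ (F ─ ⁅ x ⁆))             ≤⟨ spanning-∪ (p─q⊆p C ⁅ x ⁆) (circuit-redundant circ x∈C) (F ─ ⁅ x ⁆) ⟩
    r ((C ─ ⁅ x ⁆) ∪ (F ─ ⁅ x ⁆))   ≤⟨ r-mono (sets (#0 ⊑ #1 ⊢ (#0 ─ᵗ #2) ∪ᵗ (#1 ─ᵗ #2) ⊑ #1 ─ᵗ #2) (C ∷ F ∷ ⁅ x ⁆ ∷ []) C⊆F) ⟩
    r (F ─ ⁅ x ⁆)                   ∎
    where open ≤-Reasoning

  -- The closure of a circuit is cyclic: an element of `D` is redundant already in `D`, and deleting
  -- one outside `D` leaves the spanning set `D` intact.
  cyclicFlat⊇circuit : ∀ {D} → IsCircuit M D → ∃ λ F → IsCyclicFlat M F × D ⊆ F × r F ≤ r D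
  cyclicFlat⊇circuit {D} circ@(D⊆g , dep , proper) with flat⊇ ∣ ground M ∣ (m≤m+n _ _) D⊆g
  ... | F , D⊆F , rF , flat@(F⊆g , _) =
      F , (flat , λ x x∈F → redundant⇒circuit F⊆g x∈F (≤-trans rF (rD≤ x))) , D⊆F , rF
    where
    rD≤ : ∀ x → r D ≤ r (F ─ ⁅ x ⁆)
    rD≤ x with x ∈? D
    ... | yes x∈D = ≤-trans (circuit-redundant circ x∈D)
                      (r-mono (sets (#0 ⊑ #1 ⊢ #0 ─ᵗ #2 ⊑ #1 ─ᵗ #2) (D ∷ F ∷ ⁅ x ⁆ ∷ []) D⊆F))
    ... | no x∉D  = r-mono (sets (#0 ⊑ #1 ,, #2 ∩ᵗ #0 ⊑ ∅ᵗ ⊢ #0 ⊑ #1 ─ᵗ #2) (D ∷ F ∷ ⁅ x ⁆ ∷ []) D⊆F (∉⇒⁅⁆∩⊆∅ x∉D))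

  -- With a basis `K` of `A`, the set `I ∪ K` is dependent, whereas `(I ∩ B) ∪ K` is independent. A
  -- circuit in the former therefore leaves `B`, and so does its closure `F`. The rank inequality
  -- says that `I ∪ A` spans `F`.
  dependentOver⇒cyclicFlat : ∀ {A B I} → I ⊆ ground M → I ∩ A ⊆ ∅ →
    IndepOver A (I ∩ B) → ¬ IndepOver A I →
    ∃ λ F → IsCyclicFlat M F × ¬ F ⊆ B × r (F ∪ (I ∪ A)) ≤ r (I ∪ A)
  dependentOver⇒cyclicFlat {A} {B} {I} I⊆g dis iB dep =
    let (D , D⊆ , circ) = circuit⊆ ∣ I ∪ K ∣ ≤-refl I∪K⊆g depIK
        (F , cycF , D⊆F , rF) = cyclicFlat⊇circuit circ
    in F , cycF ,
       (λ F⊆B → proj₁ (proj₂ circ) (hereditary D ((I ∩ B) ∪ K)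
          (sets (#0 ⊑ #1 ∪ᵗ #2 ,, #0 ⊑ #3 ⊢ #0 ⊑ (#1 ∩ᵗ #3) ∪ᵗ #2) (D ∷ I ∷ K ∷ B ∷ []) D⊆ (⊆-trans D⊆F F⊆B))
          (∣∣≤r⇒Indep indepBK))) ,
       ≤-trans (spanning-∪ D⊆F rF (I ∪ A))
         (r-mono (sets (#0 ⊑ #1 ∪ᵗ #2 ,, #2 ⊑ #3 ⊢ #0 ∪ᵗ (#1 ∪ᵗ #3) ⊑ #1 ∪ᵗ #3) (D ∷ I ∷ K ∷ A ∷ []) D⊆ K⊆A))
    where
    open ≤-Reasoning
    K   = proj₁ (basis A)
    K⊆A : K ⊆ A
    K⊆A = proj₁ (proj₂ (basis A))
    iK : Indep M K
    iK  = proj₁ (proj₂ (proj₂ (basis A)))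
    eK : ∣ K ∣ ≡ r A
    eK  = proj₂ (proj₂ (proj₂ (basis A)))
    ∣∪K∣ : ∀ {J} → J ⊆ I → ∣ J ∪ K ∣ ≡ ∣ J ∣ + r A
    ∣∪K∣ {J} J⊆I = trans (∣∪∣-disjoint (sets (#0 ⊑ #1 ,, #1 ∩ᵗ #2 ⊑ ∅ᵗ ,, #3 ⊑ #2 ⊢ #0 ∩ᵗ #3 ⊑ ∅ᵗ) (J ∷ I ∷ A ∷ K ∷ []) J⊆I dis K⊆A))
                         (cong (∣ J ∣ +_) eK)
    I∪K⊆g : I ∪ K ⊆ ground M
    I∪K⊆g = sets (#0 ⊑ #1 ,, #2 ⊑ #1 ⊢ #0 ∪ᵗ #2 ⊑ #1) (I ∷ ground M ∷ K ∷ []) I⊆g (indep⊆ground K iK)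
    depIK : ¬ Indep M (I ∪ K)
    depIK i = dep (subst (_≤ r (I ∪ A)) (∣∪K∣ ⊆-refl)
      (Indep⇒∣∣≤r (sets (#0 ⊑ #1 ⊢ #2 ∪ᵗ #0 ⊑ #2 ∪ᵗ #1) (K ∷ A ∷ I ∷ []) K⊆A) i))
    indepBK : ∣ (I ∩ B) ∪ K ∣ ≤ r ((I ∩ B) ∪ K)
    indepBK = begin
      ∣ (I ∩ B) ∪ K ∣  ≡⟨ ∣∪K∣ (p∩q⊆p I B) ⟩
      ∣ I ∩ B ∣ + r A  ≤⟨ iB ⟩
      r ((I ∩ B) ∪ A)  ≡⟨ cong r (∪-comm (I ∩ B) A) ⟩
      r (A ∪ (I ∩ B))  ≤⟨ spanning-∪ K⊆A (≤-trans (≤-reflexive (sym eK)) (Indep⇒∣∣≤r ⊆-refl iK)) (I ∩ B) ⟩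
      r (K ∪ (I ∩ B))  ≡⟨ cong r (∪-comm K (I ∩ B)) ⟩
      r ((I ∩ B) ∪ K)  ∎

-- Free products

≅-refl : {M : RawMatroid n} → M ≅ M
≅-refl = refl , λ _ → refl

≅-sym : {M N : RawMatroid n} → M ≅ N → N ≅ M
≅-sym (g , i) = sym g , λ A → sym (i A)

≅-trans : {M N P : RawMatroid n} → M ≅ N → N ≅ P → M ≅ P
≅-trans (g , i) (g′ , i′) = trans g g′ , λ A → trans (i A) (i′ A)

≅⇒Indep : {M N : RawMatroid n} → M ≅ N → ∀ A → Indep M A → Indep N A
≅⇒Indep (_ , i) A h = trans (sym (i A)) h

□-cong : {M M′ N N′ : RawMatroid n} → M ≅ M′ → N ≅ N′ → (M □ N) ≅ (M′ □ N′)
□-cong {M = mkRaw g i} {mkRaw .g i′} {mkRaw h j} {mkRaw .h j′} (refl , e) (refl , f) = refl , λ A →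
  cong (⌊ A ⊆? (g ∪ h) ⌋ ∧_) (cong₂ _∧_ (e (A ∩ g)) (cong₂ _≤ᵇ_
    (cong (∣ A ∩ h ∣ ∸_) (rank-cong (mkRaw h j) (mkRaw h j′) f (A ∩ h)))
    (cong₂ _∸_ (rank-cong (mkRaw g i) (mkRaw g i′) e g) (rank-cong (mkRaw g i) (mkRaw g i′) e (A ∩ g)))))

module FreeProduct (P Q : RawMatroid n) (P∅ : Indep P ∅) where

  private
    rank≤rk : ∀ A → rank P (A ∩ ground P) ≤ rk P
    rank≤rk A = rank-mono P P∅ (p∩q⊆q A (ground P))

  -- The comparison of `ν` with `λM` without subtraction. Truncation in `λM` is harmless because the
  -- rank of a subset never exceeds `rk P`, and truncation in `ν` because it stands on the smaller
  -- side.
  □⇒ : ∀ A → Indep (P □ Q) A →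
       A ⊆ ground P ∪ ground Q × Indep P (A ∩ ground P) ×
       ∣ A ∩ ground Q ∣ + rank P (A ∩ ground P) ≤ rk P + rank Q (A ∩ ground Q)
  □⇒ A h =
    let (s , h′) = ∧-true h
        (i , le) = ∧-true h′
        d = rk P ∸ rank P (A ∩ ground P)
    in true-⌊⌋ (A ⊆? (ground P ∪ ground Q)) s , i , (begin
      ∣ A ∩ ground Q ∣ + rank P (A ∩ ground P)
        ≤⟨ +-monoˡ-≤ _ (m∸n≤o⇒m≤n+o ∣ A ∩ ground Q ∣ _ (≤ᵇ⇒≤ (ν Q (A ∩ ground Q)) d (subst T (sym le) tt))) ⟩
      (rank Q (A ∩ ground Q) + d) + rank P (A ∩ ground P)
        ≡⟨ +-assoc (rank Q (A ∩ ground Q)) d _ ⟩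
      rank Q (A ∩ ground Q) + (d + rank P (A ∩ ground P))
        ≡⟨ cong (rank Q (A ∩ ground Q) +_) (m∸n+n≡m (rank≤rk A)) ⟩
      rank Q (A ∩ ground Q) + rk P
        ≡⟨ +-comm (rank Q (A ∩ ground Q)) _ ⟩
      rk P + rank Q (A ∩ ground Q) ∎)
    where
    open ≤-Reasoning
    m∸n≤o⇒m≤n+o : ∀ m p {o} → m ∸ p ≤ o → m ≤ p + o
    m∸n≤o⇒m≤n+o m p le = ≤-trans (m≤n+m∸n m p) (+-monoʳ-≤ p le)

  □⇐ : ∀ A → A ⊆ ground P ∪ ground Q → Indep P (A ∩ ground P) →
       ∣ A ∩ ground Q ∣ + rank P (A ∩ ground P) ≤ rk P + rank Q (A ∩ ground Q) →
       Indep (P □ Q) A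
  □⇐ A s i le = true-∧ (⌊⌋-true (A ⊆? (ground P ∪ ground Q)) s) (true-∧ i (T⇒true (≤⇒≤ᵇ {ν Q (A ∩ ground Q)} {λM P (A ∩ ground P)}
    (m≤n+o⇒m∸n≤o ∣ A ∩ ground Q ∣ _ (+-cancelʳ-≤ (rank P (A ∩ ground P)) _ _ (begin
      ∣ A ∩ ground Q ∣ + rank P (A ∩ ground P)
        ≤⟨ le ⟩
      rk P + rank Q (A ∩ ground Q)
        ≡⟨ +-comm (rk P) _ ⟩
      rank Q (A ∩ ground Q) + rk P
        ≡⟨ cong (rank Q (A ∩ ground Q) +_) (sym (m∸n+n≡m (rank≤rk A))) ⟩
      rank Q (A ∩ ground Q) + (rk P ∸ rank P (A ∩ ground P) + rank P (A ∩ ground P))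
        ≡⟨ sym (+-assoc (rank Q (A ∩ ground Q)) _ _) ⟩
      (rank Q (A ∩ ground Q) + (rk P ∸ rank P (A ∩ ground P))) + rank P (A ∩ ground P) ∎))))))
    where open ≤-Reasoning

  □-∅ : Indep (P □ Q) ∅
  □-∅ = □⇐ ∅ ⊥⊆
    (subst (Indep P) (sets (⊢ ∅ᵗ ≐ ∅ᵗ ∩ᵗ #0) (ground P ∷ [])) P∅)
    (subst (λ m → m + rank P (∅ ∩ ground P) ≤ rk P + rank Q (∅ ∩ ground Q))
      (sym (∣∅∣≡0 (sets (⊢ ∅ᵗ ∩ᵗ #0 ⊑ ∅ᵗ) (ground Q ∷ []))))
      (≤-trans (rank≤rk ∅) (m≤m+n (rk P) _)))

emptyM-∅ : Indep (emptyM {n}) ∅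
emptyM-∅ {n} = ⌊⌋-true (∅ {n} ⊆? ∅) ⊆-refl

-- Together with `FreeProd-⊆` this supplies what `Split` asks of the tail of a product. The tail is
-- not shown beforehand to be a matroid; `Split` identifies it with a minor.
FreeProd-∅ : {Ns : List (RawMatroid n)} → All IsMatroid Ns → Indep (FreeProd Ns) ∅
FreeProd-∅ [] = emptyM-∅
FreeProd-∅ {Ns = N ∷ Ns} (m ∷ ms) = FreeProduct.□-∅ N (FreeProd Ns) (IsMatroid.indep-∅ m)

FreeProd-⊆ : {Ns : List (RawMatroid n)} → All IsMatroid Ns →
             ∀ A → Indep (FreeProd Ns) A → A ⊆ ground (FreeProd Ns)
FreeProd-⊆ [] A h = true-⌊⌋ (A ⊆? ∅) h
FreeProd-⊆ {Ns = N ∷ Ns} (m ∷ ms) A h =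
  proj₁ (FreeProduct.□⇒ N (FreeProd Ns) (IsMatroid.indep-∅ m) A h)

-- Free separators and free products of minors

FreeSep : RawMatroid n → Subset n → Set
FreeSep M B = B ⊆ ground M × (∀ F → IsCyclicFlat M F → F ⊆ B ⊎ B ⊆ F)

module MinorProduct {n : ℕ} (M : RawMatroid n) (isM : IsMatroid M) where
  open MatroidRank M isM
  open Minors M isM
  open CyclicFlats M isM

  module _ {A B C : Subset n} (A⊆B : A ⊆ B) (B⊆C : B ⊆ C) where
    private
      P = minor M A B
      Q = minor M B C
      open FreeProduct P Q (minor-∅ A B)

      module _ (I : Subset n) (I⊆ : I ⊆ C ─ A) where
        open ≤-Reasoning
        X = I ∩ (B ─ A)
        Y = I ∩ (C ─ B)

        X≡ : X ≡ I ∩ B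
        X≡ = sets (#0 ⊑ #1 ─ᵗ #2 ⊢ #0 ∩ᵗ (#3 ─ᵗ #2) ≐ #0 ∩ᵗ #3) (I ∷ C ∷ A ∷ B ∷ []) I⊆

        rkP : rk P + r A ≡ r B
        rkP = trans (rank-minor ⊆-refl)
                (cong r (sets (#0 ⊑ #1 ⊢ (#1 ─ᵗ #0) ∪ᵗ #0 ≐ #1) (A ∷ B ∷ []) A⊆B))

        rankQ : rank Q Y + r B ≡ r (I ∪ B)
        rankQ = trans (rank-minor (p∩q⊆q I (C ─ B)))
                  (cong r (sets (#0 ⊑ #2 ─ᵗ #3 ⊢ (#0 ∩ᵗ (#2 ─ᵗ #1)) ∪ᵗ #1 ≐ #0 ∪ᵗ #1) (I ∷ B ∷ C ∷ A ∷ []) I⊆))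

        rankP≤ : rank P X ≤ ∣ X ∣
        rankP≤ = rank≤∣∣ P (minor-∅ A B) X

        rankP≥ : Indep P X → ∣ X ∣ ≤ rank P X
        rankP≥ = rank-≥ P ⊆-refl

        ∣I∣ : ∣ I ∣ ≡ ∣ Y ∣ + ∣ X ∣
        ∣I∣ = trans (cong ∣_∣ (sets (#0 ⊑ #2 ─ᵗ #3 ⊢ #0 ≐ #0 ∩ᵗ (#2 ─ᵗ #1) ∪ᵗ #0 ∩ᵗ (#1 ─ᵗ #3)) (I ∷ B ∷ C ∷ A ∷ []) I⊆))
                    (∣∪∣-disjoint (sets (⊢ (#0 ∩ᵗ (#2 ─ᵗ #1)) ∩ᵗ (#0 ∩ᵗ (#1 ─ᵗ #3)) ⊑ ∅ᵗ) (I ∷ B ∷ C ∷ A ∷ [])))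

        bound : rk P + rank Q Y + r A ≡ r (I ∪ B)
        bound = begin-equality
          rk P + rank Q Y + r A   ≡⟨ cong (_+ r A) (+-comm (rk P) _) ⟩
          rank Q Y + rk P + r A   ≡⟨ +-assoc (rank Q Y) (rk P) (r A) ⟩
          rank Q Y + (rk P + r A) ≡⟨ cong (rank Q Y +_) rkP ⟩
          rank Q Y + r B          ≡⟨ rankQ ⟩
          r (I ∪ B)               ∎

    -- After `rank-minor` the two minors disappear from the product condition and only ranks in `M`
    -- remain. Comparing the product with `minor M A C` then amounts to comparing `r (I ∪ B)` with
    -- `r (I ∪ A)`.
    minor-□⇒ : ∀ I → Indep (P □ Q) I →
               I ⊆ C ─ A × IndepOver A (I ∩ B) × ∣ I ∣ + r A ≤ r (I ∪ B)
    minor-□⇒ I h = I⊆ , subst (IndepOver A) (X≡ I I⊆) (proj₂ (minor⇒ A B _ iP)) , (begin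
        ∣ I ∣ + r A                            ≡⟨ cong (_+ r A) (∣I∣ I I⊆) ⟩
        ∣ Y I I⊆ ∣ + ∣ X I I⊆ ∣ + r A          ≤⟨ +-monoˡ-≤ (r A) (+-monoʳ-≤ ∣ Y I I⊆ ∣ (rankP≥ I I⊆ iP)) ⟩
        ∣ Y I I⊆ ∣ + rank P (X I I⊆) + r A     ≤⟨ +-monoˡ-≤ (r A) le ⟩
        rk P + rank Q (Y I I⊆) + r A           ≡⟨ bound I I⊆ ⟩
        r (I ∪ B)                              ∎)
      where
      open ≤-Reasoning
      I⊆ : I ⊆ C ─ A
      I⊆ = ⊆-trans (proj₁ (□⇒ I h))
        (sets (#0 ⊑ #1 ,, #1 ⊑ #2 ⊢ (#1 ─ᵗ #0) ∪ᵗ (#2 ─ᵗ #1) ⊑ #2 ─ᵗ #0) (A ∷ B ∷ C ∷ []) A⊆B B⊆C)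
      iP = proj₁ (proj₂ (□⇒ I h))
      le = proj₂ (proj₂ (□⇒ I h))

    minor-□⇐ : ∀ I → I ⊆ C ─ A → IndepOver A (I ∩ B) → ∣ I ∣ + r A ≤ r (I ∪ B) →
               Indep (P □ Q) I
    minor-□⇐ I I⊆ iB le = □⇐ I
      (⊆-trans I⊆ (sets (⊢ #2 ─ᵗ #0 ⊑ (#1 ─ᵗ #0) ∪ᵗ (#2 ─ᵗ #1)) (A ∷ B ∷ C ∷ [])))
      (minor⇐ A B _ (p∩q⊆q I (B ─ A)) (subst (IndepOver A) (sym (X≡ I I⊆)) iB))
      (+-cancelʳ-≤ (r A) _ _ (begin
        ∣ Y I I⊆ ∣ + rank P (X I I⊆) + r A     ≤⟨ +-monoˡ-≤ (r A) (+-monoʳ-≤ ∣ Y I I⊆ ∣ (rankP≤ I I⊆)) ⟩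
        ∣ Y I I⊆ ∣ + ∣ X I I⊆ ∣ + r A          ≡⟨ cong (_+ r A) (sym (∣I∣ I I⊆)) ⟩
        ∣ I ∣ + r A                            ≤⟨ le ⟩
        r (I ∪ B)                              ≡⟨ sym (bound I I⊆) ⟩
        rk P + rank Q (Y I I⊆) + r A           ∎))
      where open ≤-Reasoning

    minor-□ : C ⊆ ground M → FreeSep M B → minor M A C ≅ (P □ Q)
    minor-□ C⊆g (_ , sep) = ground≡ , λ I → ⇔⇒≡ (to I) (from I)
      where
      ground≡ : C ─ A ≡ (B ─ A) ∪ (C ─ B)
      ground≡ = sets (#0 ⊑ #1 ,, #1 ⊑ #2 ⊢ #2 ─ᵗ #0 ≐ (#1 ─ᵗ #0) ∪ᵗ (#2 ─ᵗ #1)) (A ∷ B ∷ C ∷ []) A⊆B B⊆C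
      to : ∀ I → Indep (minor M A C) I → Indep (P □ Q) I
      to I h = let (I⊆ , iA) = minor⇒ A C I h in
        minor-□⇐ I I⊆ (IndepOver-⊆ (p∩q⊆p I B) iA)
          (≤-trans iA (r-mono (sets (#1 ⊑ #2 ⊢ #0 ∪ᵗ #1 ⊑ #0 ∪ᵗ #2) (I ∷ A ∷ B ∷ []) A⊆B)))
      spanned : ∀ I → ∣ I ∣ + r A ≤ r (I ∪ B) →
                (∃ λ F → IsCyclicFlat M F × ¬ F ⊆ B × r (F ∪ (I ∪ A)) ≤ r (I ∪ A)) → IndepOver A I
      spanned I le (F , cycF , F⊈B , rF) with sep F cycF
      ... | inj₁ F⊆B = ⊥-elim (F⊈B F⊆B)
      ... | inj₂ B⊆F = ≤-trans le (≤-trans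
            (r-mono (sets (#1 ⊑ #2 ⊢ #0 ∪ᵗ #1 ⊑ #2 ∪ᵗ (#0 ∪ᵗ #3)) (I ∷ B ∷ F ∷ A ∷ []) B⊆F)) rF)
      from : ∀ I → Indep (P □ Q) I → Indep (minor M A C) I
      from I h = let (I⊆ , iB , le) = minor-□⇒ I h in
        minor⇐ A C I I⊆ (decidable-stable (∣ I ∣ + r A ≤? r (I ∪ A)) λ dep → dep (spanned I le
          (dependentOver⇒cyclicFlat {A} {B} {I}
             (sets (#0 ⊑ #1 ─ᵗ #2 ,, #1 ⊑ #3 ⊢ #0 ⊑ #3) (I ∷ C ∷ A ∷ ground M ∷ []) I⊆ C⊆g)
             (sets (#0 ⊑ #1 ─ᵗ #2 ⊢ #0 ∩ᵗ #2 ⊑ ∅ᵗ) (I ∷ C ∷ A ∷ []) I⊆) iB dep)))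

  -- The cut is forced: `P` can only be `minor M A B` for `B = A ∪ ground P`. General free
  -- separators `A` and `C`, instead of `∅` and the ground set, allow the splitting to be repeated
  -- on `Q`, which will be the tail of a longer product.
  module Split {A C : Subset n} (A⊆C : A ⊆ C) (sepA : FreeSep M A) (sepC : FreeSep M C)
               (P Q : RawMatroid n) (P∅ : Indep P ∅) (Q∅ : Indep Q ∅)
               (P⊆ : ∀ I → Indep P I → I ⊆ ground P) (Q⊆ : ∀ I → Indep Q I → I ⊆ ground Q)
               (disjoint : ground P ∩ ground Q ⊆ ∅) (M≅ : minor M A C ≅ (P □ Q)) where
    open FreeProduct P Q P∅
    open ≤-Reasoning

    private
      gP = ground P
      gQ = ground Q

    B : Subset n
    B = A ∪ gP

    private
      ground≡ : C ─ A ≡ gP ∪ gQ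
      ground≡ = proj₁ M≅

    A⊆B : A ⊆ B
    A⊆B = p⊆p∪q gP

    B⊆C : B ⊆ C
    B⊆C = sets (#0 ⊑ #1 ,, #1 ─ᵗ #0 ≐ #2 ∪ᵗ #3 ⊢ #0 ∪ᵗ #2 ⊑ #1) (A ∷ C ∷ gP ∷ gQ ∷ []) A⊆C ground≡

    groundP : gP ≡ B ─ A
    groundP = sets (#1 ─ᵗ #0 ≐ #2 ∪ᵗ #3 ⊢ #2 ≐ (#0 ∪ᵗ #2) ─ᵗ #0) (A ∷ C ∷ gP ∷ gQ ∷ []) ground≡

    groundQ : gQ ≡ C ─ B
    groundQ = sets (#1 ─ᵗ #0 ≐ #2 ∪ᵗ #3 ,, #2 ∩ᵗ #3 ⊑ ∅ᵗ ⊢ #3 ≐ #1 ─ᵗ (#0 ∪ᵗ #2))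
                (A ∷ C ∷ gP ∷ gQ ∷ []) ground≡ disjoint

    private
      -- Such an `I` misses `ground Q`, so its nullity there is zero and the product condition
      -- reduces to independence in `P`.
      P⇔ : ∀ I → I ⊆ B ─ A → Indep P I ⇔ IndepOver A I
      P⇔ I I⊆ = mk⇔ to from
        where
        I⊆gP : I ⊆ gP
        I⊆gP = ⊆-trans I⊆ (⊆-reflexive (sym groundP))
        ∩gP : I ∩ gP ≡ I
        ∩gP = sets (#0 ⊑ #1 ⊢ #0 ∩ᵗ #1 ≐ #0) (I ∷ gP ∷ []) I⊆gP
        ∩gQ : I ∩ gQ ⊆ ∅
        ∩gQ = sets (#0 ⊑ #1 ,, #1 ∩ᵗ #2 ⊑ ∅ᵗ ⊢ #0 ∩ᵗ #2 ⊑ ∅ᵗ) (I ∷ gP ∷ gQ ∷ []) I⊆gP disjoint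
        to : Indep P I → IndepOver A I
        to h = proj₂ (minor⇒ A C I (≅⇒Indep (≅-sym M≅) I
          (□⇐ I (⊆-trans I⊆gP (p⊆p∪q gQ)) (subst (Indep P) (sym ∩gP) h)
            (subst (λ m → m + rank P (I ∩ gP) ≤ rk P + rank Q (I ∩ gQ)) (sym (∣∅∣≡0 ∩gQ))
              (≤-trans (rank-mono P P∅ (p∩q⊆q I gP)) (m≤m+n (rk P) _))))))
        from : IndepOver A I → Indep P I
        from h = subst (Indep P) ∩gP (proj₁ (proj₂ (□⇒ I (≅⇒Indep M≅ I (minor⇐ A C I
          (sets (#0 ⊑ #1 ─ᵗ #2 ,, #1 ⊑ #3 ⊢ #0 ⊑ #3 ─ᵗ #2) (I ∷ B ∷ A ∷ C ∷ []) I⊆ B⊆C) h)))))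

    module P⇔ (I : Subset n) (I⊆ : I ⊆ B ─ A) = Equivalence (P⇔ I I⊆)

    P≅ : P ≅ minor M A B
    P≅ = groundP , λ I → ⇔⇒≡
      (λ h → let I⊆ : I ⊆ B ─ A
                 I⊆ = ⊆-trans (P⊆ I h) (⊆-reflexive groundP) in minor⇐ A B I I⊆ (P⇔.to I I⊆ h))
      (λ h → let (I⊆ , i) = minor⇒ A B I h in P⇔.from I I⊆ i)

    private
      -- `J` is a basis of `B` over `A`, so `λM P J` is zero. Joining `J` to `I ⊆ ground Q` leaves
      -- no room for nullity: `I ∪ J` is independent in the product exactly when `I` is independent
      -- in `Q`.
      J = proj₁ (basisOver A B)

      J⊆ : J ⊆ B ─ A
      J⊆ = proj₁ (proj₂ (basisOver A B))

      iJ : IndepOver A J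
      iJ = proj₁ (proj₂ (proj₂ (basisOver A B)))

      J-spans : r (B ∪ A) ≤ r (J ∪ A)
      J-spans = proj₂ (proj₂ (proj₂ (basisOver A B)))

      B∪A : B ∪ A ≡ B
      B∪A = sets (#0 ⊑ #1 ⊢ #1 ∪ᵗ #0 ≐ #1) (A ∷ B ∷ []) A⊆B

      rJ : r B ≤ r (J ∪ A)
      rJ = subst (λ X → r X ≤ r (J ∪ A)) B∪A J-spans

      J∪A⊆B : J ∪ A ⊆ B
      J∪A⊆B = sets (#0 ⊑ #1 ─ᵗ #2 ,, #2 ⊑ #1 ⊢ #0 ∪ᵗ #2 ⊑ #1) (J ∷ B ∷ A ∷ []) J⊆ A⊆B

      rB : ∣ J ∣ + r A ≡ r B
      rB = ≤-antisym (≤-trans iJ (r-mono J∪A⊆B)) (≤-trans rJ (r-∪≤′ J A))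

      rkP≤ : rk P ≤ rank P J
      rkP≤ = ≤-trans (+-cancelʳ-≤ (r A) _ _ (begin
        rk P + r A                             ≡⟨ cong (_+ r A) (rank-cong P (minor M A B) (proj₂ P≅) gP) ⟩
        rank (minor M A B) gP + r A            ≡⟨ rank-minor (⊆-reflexive groundP) ⟩
        r (gP ∪ A)                             ≡⟨ cong r (∪-comm gP A) ⟩
        r B                                    ≡⟨ sym rB ⟩
        ∣ J ∣ + r A                            ∎))
        (rank-≥ P ⊆-refl (P⇔.from J J⊆ iJ))

      module _ (I : Subset n) (I⊆ : I ⊆ C ─ B) where
        I⊆gQ : I ⊆ gQ
        I⊆gQ = ⊆-trans I⊆ (⊆-reflexive (sym groundQ))

        ∩gP : (I ∪ J) ∩ gP ≡ J
        ∩gP = sets (#0 ⊑ #1 ,, #2 ⊑ #3 ,, #3 ∩ᵗ #1 ⊑ ∅ᵗ ⊢ (#0 ∪ᵗ #2) ∩ᵗ #3 ≐ #2)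
                (I ∷ gQ ∷ J ∷ gP ∷ []) I⊆gQ (⊆-trans J⊆ (⊆-reflexive (sym groundP))) disjoint

        ∩gQ : (I ∪ J) ∩ gQ ≡ I
        ∩gQ = sets (#0 ⊑ #1 ,, #2 ⊑ #3 ,, #3 ∩ᵗ #1 ⊑ ∅ᵗ ⊢ (#0 ∪ᵗ #2) ∩ᵗ #1 ≐ #0)
                (I ∷ gQ ∷ J ∷ gP ∷ []) I⊆gQ (⊆-trans J⊆ (⊆-reflexive (sym groundP))) disjoint

        ∣I∪J∣ : ∣ I ∪ J ∣ + r A ≡ ∣ I ∣ + r B
        ∣I∪J∣ = begin-equality
          ∣ I ∪ J ∣ + r A         ≡⟨ cong (_+ r A) (∣∪∣-disjoint (sets (#0 ⊑ #3 ─ᵗ #1 ,, #2 ⊑ #1 ─ᵗ #4 ⊢ #0 ∩ᵗ #2 ⊑ ∅ᵗ)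
                                       (I ∷ B ∷ J ∷ C ∷ A ∷ []) I⊆ J⊆)) ⟩
          ∣ I ∣ + ∣ J ∣ + r A     ≡⟨ +-assoc ∣ I ∣ _ _ ⟩
          ∣ I ∣ + (∣ J ∣ + r A)   ≡⟨ cong (∣ I ∣ +_) rB ⟩
          ∣ I ∣ + r B             ∎

        Q⇒ : Indep Q I → IndepOver B I
        Q⇒ h = begin
          ∣ I ∣ + r B         ≡⟨ sym ∣I∪J∣ ⟩
          ∣ I ∪ J ∣ + r A     ≤⟨ proj₂ (minor⇒ A C (I ∪ J) (≅⇒Indep (≅-sym M≅) (I ∪ J) indep□)) ⟩
          r ((I ∪ J) ∪ A)     ≤⟨ r-mono (sets (#0 ∪ᵗ #1 ⊑ #2 ⊢ (#3 ∪ᵗ #0) ∪ᵗ #1 ⊑ #3 ∪ᵗ #2) (J ∷ A ∷ B ∷ I ∷ []) J∪A⊆B) ⟩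
          r (I ∪ B)           ∎
          where
          indep□ : Indep (P □ Q) (I ∪ J)
          indep□ = □⇐ (I ∪ J)
            (sets (#0 ⊑ #1 ,, #2 ⊑ #3 ⊢ #0 ∪ᵗ #2 ⊑ #3 ∪ᵗ #1) (I ∷ gQ ∷ J ∷ gP ∷ []) I⊆gQ (⊆-trans J⊆ (⊆-reflexive (sym groundP))))
            (subst (Indep P) (sym ∩gP) (P⇔.from J J⊆ iJ))
            (subst₂ (λ X Y → ∣ Y ∣ + rank P X ≤ rk P + rank Q Y) (sym ∩gP) (sym ∩gQ) (begin
              ∣ I ∣ + rank P J     ≤⟨ +-mono-≤ (rank-≥ Q ⊆-refl h) (rank-mono P P∅ (⊆-trans J⊆ (⊆-reflexive (sym groundP)))) ⟩
              rank Q I + rk P      ≡⟨ +-comm (rank Q I) _ ⟩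
              rk P + rank Q I      ∎))

        Q⇐ : IndepOver B I → Indep Q I
        Q⇐ h = ∣∣≤rank⇒Indep Q Q∅ (+-cancelʳ-≤ (rank P J) _ _ (begin
            ∣ I ∣ + rank P J       ≤⟨ le ⟩
            rk P + rank Q I        ≤⟨ +-monoˡ-≤ _ rkP≤ ⟩
            rank P J + rank Q I    ≡⟨ +-comm (rank P J) _ ⟩
            rank Q I + rank P J    ∎))
          where
          indepA : IndepOver A (I ∪ J)
          indepA = begin
            ∣ I ∪ J ∣ + r A     ≡⟨ ∣I∪J∣ ⟩
            ∣ I ∣ + r B         ≤⟨ h ⟩
            r (I ∪ B)           ≡⟨ cong r (∪-comm I B) ⟩
            r (B ∪ I)           ≤⟨ spanning-∪ J∪A⊆B rJ I ⟩
            r ((J ∪ A) ∪ I)     ≡⟨ cong r (sets (⊢ (#0 ∪ᵗ #1) ∪ᵗ #2 ≐ (#2 ∪ᵗ #0) ∪ᵗ #1) (J ∷ A ∷ I ∷ [])) ⟩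
            r ((I ∪ J) ∪ A)     ∎
          I∪J⊆ : I ∪ J ⊆ C ─ A
          I∪J⊆ = sets (#0 ⊑ #1 ─ᵗ #2 ,, #3 ⊑ #2 ─ᵗ #4 ,, #2 ⊑ #1 ,, #4 ⊑ #2 ⊢ #0 ∪ᵗ #3 ⊑ #1 ─ᵗ #4)
                   (I ∷ C ∷ B ∷ J ∷ A ∷ []) I⊆ J⊆ B⊆C A⊆B
          le : ∣ I ∣ + rank P J ≤ rk P + rank Q I
          le = subst₂ (λ X Y → ∣ Y ∣ + rank P X ≤ rk P + rank Q Y) ∩gP ∩gQ
                 (proj₂ (proj₂ (□⇒ (I ∪ J) (≅⇒Indep M≅ (I ∪ J) (minor⇐ A C (I ∪ J) I∪J⊆ indepA)))))

    Q≅ : Q ≅ minor M B C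
    Q≅ = groundQ , λ I → ⇔⇒≡
      (λ h → let I⊆ : I ⊆ C ─ B
                 I⊆ = ⊆-trans (Q⊆ I h) (⊆-reflexive groundQ) in minor⇐ B C I I⊆ (Q⇒ I I⊆ h))
      (λ h → let (I⊆ , i) = minor⇒ B C I h in Q⇐ I I⊆ i)

    private
      -- Extend a relative basis of F ∖ d by d: the result is dependent over A because F is cyclic,
      -- so the product formula forces B into its span, that is, into F.
      spanned : ∀ {F d} → IsCyclicFlat M F → A ⊆ F → F ⊆ C → d ∈ F → d ∉ B → B ⊆ F
      spanned {F} {d} ((F⊆g , flat) , cyc) A⊆F F⊆C d∈F d∉B {x} x∈B =
        decidable-stable (x ∈? F) λ x∉F → <⇒≱ (flat x (proj₁ sepC (B⊆C x∈B)) x∉F) (begin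
          r (F ∪ ⁅ x ⁆)           ≤⟨ r-mono (sets (#0 ⊑ #1 ⊢ #2 ∪ᵗ #0 ⊑ #2 ∪ᵗ #1) (⁅ x ⁆ ∷ B ∷ F ∷ []) (∈⇒⁅⁆⊆ x∈B)) ⟩
          r (F ∪ B)               ≤⟨ spanning-∪ E∪A⊆F rF B ⟩
          r ((E ∪ A) ∪ B)         ≤⟨ r-mono (sets (#2 ⊑ #3 ⊢ (#0 ∪ᵗ #2) ∪ᵗ #3 ⊑ (#0 ∪ᵗ #1) ∪ᵗ #3) (E ∷ ⁅ d ⁆ ∷ A ∷ B ∷ []) A⊆B) ⟩
          r (Ed ∪ B)              ≤⟨ ≤-pred rEd ⟩
          ∣ E ∣ + r A             ≤⟨ iE ⟩
          r (E ∪ A)               ≤⟨ r-mono E∪A⊆F ⟩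
          r F                     ∎)
        where
        relBasis = basisOver A (F ─ ⁅ d ⁆)
        E = proj₁ relBasis
        Ed = E ∪ ⁅ d ⁆
        E⊆ : E ⊆ (F ─ ⁅ d ⁆) ─ A
        E⊆ = proj₁ (proj₂ relBasis)
        iE : IndepOver A E
        iE = proj₁ (proj₂ (proj₂ relBasis))
        E∪A⊆F : E ∪ A ⊆ F
        E∪A⊆F = sets (#0 ⊑ (#1 ─ᵗ #2) ─ᵗ #3 ,, #3 ⊑ #1 ⊢ #0 ∪ᵗ #3 ⊑ #1) (E ∷ F ∷ ⁅ d ⁆ ∷ A ∷ []) E⊆ A⊆F
        d∉E : d ∉ E
        d∉E = ⁅⁆∩⊆∅⇒∉ (sets (#0 ⊑ (#1 ─ᵗ #2) ─ᵗ #3 ⊢ #2 ∩ᵗ #0 ⊑ ∅ᵗ) (E ∷ F ∷ ⁅ d ⁆ ∷ A ∷ []) E⊆)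
        rF : r F ≤ r (E ∪ A)
        rF = begin
          r F                   ≤⟨ cyclic-redundant cyc d∈F ⟩
          r (F ─ ⁅ d ⁆)         ≤⟨ r-mono (p⊆p∪q A) ⟩
          r ((F ─ ⁅ d ⁆) ∪ A)   ≤⟨ proj₂ (proj₂ (proj₂ relBasis)) ⟩
          r (E ∪ A)             ∎
        ∣Ed∣ : ∣ Ed ∣ + r A ≡ suc (∣ E ∣ + r A)
        ∣Ed∣ = cong (_+ r A) (∣∪⁅⁆∣ d∉E)
        dep : ¬ IndepOver A Ed
        dep i = <⇒≱ (≤-trans (≤-reflexive (sym ∣Ed∣)) i) (begin
          r (Ed ∪ A)    ≤⟨ r-mono (sets (#0 ∪ᵗ #3 ⊑ #1 ,, #2 ⊑ #1 ⊢ (#0 ∪ᵗ #2) ∪ᵗ #3 ⊑ #1) (E ∷ F ∷ ⁅ d ⁆ ∷ A ∷ []) E∪A⊆F (∈⇒⁅⁆⊆ d∈F)) ⟩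
          r F           ≤⟨ rF ⟩
          r (E ∪ A)     ≤⟨ r-∪≤′ E A ⟩
          ∣ E ∣ + r A   ∎)
        Ed⊆ : Ed ⊆ C ─ A
        Ed⊆ = ⊆-trans
          (sets (#0 ⊑ (#1 ─ᵗ #2) ─ᵗ #3 ,, #2 ⊑ #1 ,, #2 ∩ᵗ #4 ⊑ ∅ᵗ ,, #3 ⊑ #4 ⊢ #0 ∪ᵗ #2 ⊑ #1 ─ᵗ #3)
            (E ∷ F ∷ ⁅ d ⁆ ∷ A ∷ B ∷ []) E⊆ (∈⇒⁅⁆⊆ d∈F) (∉⇒⁅⁆∩⊆∅ d∉B) A⊆B)
          (sets (#0 ⊑ #1 ⊢ #0 ─ᵗ #2 ⊑ #1 ─ᵗ #2) (F ∷ C ∷ A ∷ []) F⊆C)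
        rEd : r (Ed ∪ B) < suc (∣ E ∣ + r A)
        rEd = ≰⇒> λ le → dep (proj₂ (minor⇒ A C Ed (≅⇒Indep (≅-sym (≅-trans M≅ (□-cong P≅ Q≅))) Ed
          (minor-□⇐ A⊆B B⊆C Ed Ed⊆
            (IndepOver-⊆ (sets (#1 ∩ᵗ #2 ⊑ ∅ᵗ ⊢ (#0 ∪ᵗ #1) ∩ᵗ #2 ⊑ #0) (E ∷ ⁅ d ⁆ ∷ B ∷ []) (∉⇒⁅⁆∩⊆∅ d∉B)) iE)
            (subst (_≤ r (Ed ∪ B)) (sym ∣Ed∣) le)))))

    sepB : FreeSep M B
    sepB = ⊆-trans B⊆C (proj₁ sepC) , compare
      where
      compare : ∀ F → IsCyclicFlat M F → F ⊆ B ⊎ B ⊆ F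
      compare F cycF with F ⊆? B
      ... | yes F⊆B = inj₁ F⊆B
      ... | no F⊈B with proj₂ sepA F cycF | proj₂ sepC F cycF
      ...   | inj₁ F⊆A | _ = ⊥-elim (F⊈B (⊆-trans F⊆A A⊆B))
      ...   | inj₂ _   | inj₂ C⊆F = inj₂ (⊆-trans B⊆C C⊆F)
      ...   | inj₂ A⊆F | inj₁ F⊆C = let (d , d∈F , d∉B) = ⊈⇒∃ F⊈B in
                inj₂ (spanned cycF A⊆F F⊆C d∈F d∉B)

-- The lattice generated by the cyclic flats

-- The comparability in `FreeSep M B` is `Gap M B B`, so facts about gaps apply to free separators
-- directly.
Gap : RawMatroid n → Subset n → Subset n → Set
Gap M U V = ∀ F → IsCyclicFlat M F → F ⊆ U ⊎ V ⊆ F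

Gap-mono : ∀ {M : RawMatroid n} {U U′ V V′} → U ⊆ U′ → V′ ⊆ V → Gap M U V → Gap M U′ V′
Gap-mono U⊆ V⊇ gap F c with gap F c
... | inj₁ F⊆U = inj₁ (⊆-trans F⊆U U⊆)
... | inj₂ V⊆F = inj₂ (⊆-trans V⊇ V⊆F)

InD⇒⊆ground : ∀ {M : RawMatroid n} {Y} → InD M Y → Y ⊆ ground M
InD⇒⊆ground (cf ((s , _) , _)) = s
InD⇒⊆ground bot = ⊥⊆
InD⇒⊆ground top = ⊆-refl
InD⇒⊆ground {M = M} (join {A} {B} dA dB) =
  sets (#0 ⊑ #2 ,, #1 ⊑ #2 ⊢ #0 ∪ᵗ #1 ⊑ #2) (A ∷ B ∷ ground M ∷ []) (InD⇒⊆ground dA) (InD⇒⊆ground dB)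
InD⇒⊆ground (meet {A} {B} dA dB) = ⊆-trans (p∩q⊆p A B) (InD⇒⊆ground dA)

-- The sets below U or above V form a sublattice.
Gap⇒InD : ∀ {M : RawMatroid n} {U V} → V ⊆ ground M → Gap M U V → ∀ {Y} → InD M Y → Y ⊆ U ⊎ V ⊆ Y
Gap⇒InD V⊆ gap (cf c) = gap _ c
Gap⇒InD V⊆ gap bot = inj₁ ⊥⊆
Gap⇒InD V⊆ gap top = inj₂ V⊆
Gap⇒InD {U = U} {V} V⊆ gap (join {A} {B} dA dB) with Gap⇒InD V⊆ gap dA | Gap⇒InD V⊆ gap dB
... | inj₂ V⊆A | _        = inj₂ (⊆-trans V⊆A (p⊆p∪q B))
... | inj₁ _   | inj₂ V⊆B = inj₂ (⊆-trans V⊆B (q⊆p∪q A B))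
... | inj₁ A⊆U | inj₁ B⊆U = inj₁ (sets (#0 ⊑ #2 ,, #1 ⊑ #2 ⊢ #0 ∪ᵗ #1 ⊑ #2) (A ∷ B ∷ U ∷ []) A⊆U B⊆U)
Gap⇒InD {U = U} {V} V⊆ gap (meet {A} {B} dA dB) with Gap⇒InD V⊆ gap dA | Gap⇒InD V⊆ gap dB
... | inj₁ A⊆U | _        = inj₁ (⊆-trans (p∩q⊆p A B) A⊆U)
... | inj₂ _   | inj₁ B⊆U = inj₁ (⊆-trans (p∩q⊆q A B) B⊆U)
... | inj₂ V⊆A | inj₂ V⊆B = inj₂ (sets (#2 ⊑ #0 ,, #2 ⊑ #1 ⊢ #2 ⊑ #0 ∩ᵗ #1) (A ∷ B ∷ V ∷ []) V⊆A V⊆B)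

FreeSep⇒comparable : ∀ {M : RawMatroid n} {X} → FreeSep M X → ∀ {Y} → InD M Y → Y ⊆ X ⊎ X ⊆ Y
FreeSep⇒comparable (X⊆ , sep) = Gap⇒InD X⊆ sep

pinchpoint⇒FreeSep : ∀ {M : RawMatroid n} {X} → IsPinchpoint M X → FreeSep M X
pinchpoint⇒FreeSep (d , pinch) = InD⇒⊆ground d , λ F c → swap (pinch F (cf c))

FreeSep⇒pinchpoint : ∀ {M : RawMatroid n} {X} → FreeSep M X → InD M X → IsPinchpoint M X
FreeSep⇒pinchpoint sep d = d , λ Y dY → swap (FreeSep⇒comparable sep dY)

∅-pinchpoint : (M : RawMatroid n) → IsPinchpoint M ∅
∅-pinchpoint M = bot , λ Y _ → inj₁ ⊥⊆

ground-pinchpoint : (M : RawMatroid n) → IsPinchpoint M (ground M)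
ground-pinchpoint M = top , λ Y d → inj₂ (InD⇒⊆ground d)

Uniform-cong : {M N : RawMatroid n} → M ≅ N → Uniform M → Uniform N
Uniform-cong {M = mkRaw g i} {mkRaw .g j} (refl , e) (k , u) = k , λ A A⊆ →
  mk⇔ (λ h → Equivalence.to (u A A⊆) (trans (e A) h))
      (λ c → trans (sym (e A)) (Equivalence.from (u A A⊆) c))

-- Pinchpoints around a free separator, and uniform minors

module Separators {n : ℕ} (M : RawMatroid n) (isM : IsMatroid M) where
  open MatroidRank M isM
  open Minors M isM
  open CyclicFlats M isM

  flat? : ∀ F → Dec (IsFlat M F)
  flat? F = (F ⊆? ground M) ×-dec
    all? (λ x → (x ∈? ground M) →-dec (¬? (x ∈? F) →-dec (r F <? r (F ∪ ⁅ x ⁆))))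

  -- Instead of searching for circuits, the test uses the rank criterion for cyclicity.
  cyclicFlat? : ∀ F → Dec (IsCyclicFlat M F)
  cyclicFlat? F with flat? F
  ... | no ¬flat = no (λ c → ¬flat (proj₁ c))
  ... | yes flat = map′
    (λ h → flat , λ x x∈F → redundant⇒circuit (proj₁ flat) x∈F (h x x∈F))
    (λ (_ , cyc) x x∈F → cyclic-redundant cyc x∈F)
    (all? (λ x → (x ∈? F) →-dec (r F ≤? r (F ─ ⁅ x ⁆))))

  -- `U` is the union of the listed cyclic flats inside `B`, hence a member of the lattice even if
  -- `B` is not. The empty union is `bot`; dually, `above` starts its intersection from `top`.
  below : ∀ B (Bs : List (Subset n)) →
          ∃ λ U → InD M U × U ⊆ B × (∀ F → F ∈ₗ Bs → IsCyclicFlat M F → F ⊆ B → F ⊆ U)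
  below B [] = ∅ , bot , ⊥⊆ , λ _ ()
  below B (F ∷ Bs) with below B Bs | cyclicFlat? F ×-dec (F ⊆? B)
  ... | U , d , U⊆B , ub | yes (c , F⊆B) =
        F ∪ U , join (cf c) d , sets (#0 ⊑ #2 ,, #1 ⊑ #2 ⊢ #0 ∪ᵗ #1 ⊑ #2) (F ∷ U ∷ B ∷ []) F⊆B U⊆B ,
        λ { _ (here refl) _ _ → p⊆p∪q U ; G (there i) cG G⊆B → ⊆-trans (ub G i cG G⊆B) (q⊆p∪q F U) }
  ... | U , d , U⊆B , ub | no ¬F =
        U , d , U⊆B , λ { _ (here refl) c F⊆B → ⊥-elim (¬F (c , F⊆B)) ; G (there i) → ub G i }

  above : ∀ B → B ⊆ ground M → (Bs : List (Subset n)) →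
          ∃ λ V → InD M V × B ⊆ V × (∀ F → F ∈ₗ Bs → IsCyclicFlat M F → B ⊆ F → V ⊆ F)
  above B B⊆ [] = ground M , top , B⊆ , λ _ ()
  above B B⊆ (F ∷ Bs) with above B B⊆ Bs | cyclicFlat? F ×-dec (B ⊆? F)
  ... | V , d , B⊆V , lb | yes (c , B⊆F) =
        F ∩ V , meet (cf c) d , sets (#2 ⊑ #0 ,, #2 ⊑ #1 ⊢ #2 ⊑ #0 ∩ᵗ #1) (F ∷ V ∷ B ∷ []) B⊆F B⊆V ,
        λ { _ (here refl) _ _ → p∩q⊆p F V ; G (there i) cG B⊆G → ⊆-trans (p∩q⊆q F V) (lb G i cG B⊆G) }
  ... | V , d , B⊆V , lb | no ¬F =
        V , d , B⊆V , λ { _ (here refl) c B⊆F → ⊥-elim (¬F (c , B⊆F)) ; G (there i) → lb G i }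

  -- Every cyclic flat lies inside `B`, hence in `U`, or contains `B`, hence `V`. As `U ⊆ V`, this
  -- gap makes both ends comparable to all cyclic flats.
  pinchpoints-around : ∀ {B} → FreeSep M B →
    ∃ λ U → ∃ λ V → IsPinchpoint M U × IsPinchpoint M V × U ⊆ B × B ⊆ V × Gap M U V
  pinchpoints-around {B} (B⊆ , sep) =
    let (U , dU , U⊆B , ub) = below B (allSubsets n)
        (V , dV , B⊆V , lb) = above B B⊆ (allSubsets n)
    in around U V dU dV U⊆B B⊆V (λ F → ub F (∈-allSubsets F)) (λ F → lb F (∈-allSubsets F))
    where
    around : ∀ U V → InD M U → InD M V → U ⊆ B → B ⊆ V →
      (∀ F → IsCyclicFlat M F → F ⊆ B → F ⊆ U) → (∀ F → IsCyclicFlat M F → B ⊆ F → V ⊆ F) →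
      ∃ λ U → ∃ λ V → IsPinchpoint M U × IsPinchpoint M V × U ⊆ B × B ⊆ V × Gap M U V
    around U V dU dV U⊆B B⊆V ub lb = U , V ,
      FreeSep⇒pinchpoint (InD⇒⊆ground dU , Gap-mono {M = M} ⊆-refl (⊆-trans U⊆B B⊆V) gap) dU ,
      FreeSep⇒pinchpoint (InD⇒⊆ground dV , Gap-mono {M = M} (⊆-trans U⊆B B⊆V) ⊆-refl gap) dV ,
      U⊆B , B⊆V , gap
      where
      gap : Gap M U V
      gap F c with sep F c
      ... | inj₁ F⊆B = inj₁ (ub F c F⊆B)
      ... | inj₂ B⊆F = inj₂ (lb F c B⊆F)

  -- If a set `Z` of size at most `r B ∸ r A` were dependent over `A`, then `Z ∪ A` would span a
  -- cyclic flat outside `A`. By the gap that flat contains `B`, so `Z ∪ A` has rank at least `r B`,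
  -- and `Z` is independent over `A` after all.
  Gap⇒Uniform : ∀ {A B} → A ⊆ B → B ⊆ ground M → Gap M A B → Uniform (minor M A B)
  Gap⇒Uniform {A} {B} A⊆B B⊆ gap = r B ∸ r A , λ Z Z⊆ → mk⇔ (to Z Z⊆) (from Z Z⊆)
    where
    to : ∀ Z → Z ⊆ B ─ A → Indep (minor M A B) Z → ∣ Z ∣ ≤ r B ∸ r A
    to Z Z⊆ h = m+n≤o⇒m≤o∸n ∣ Z ∣ (≤-trans (proj₂ (minor⇒ A B Z h))
      (r-mono (sets (#0 ⊑ #1 ─ᵗ #2 ,, #2 ⊑ #1 ⊢ #0 ∪ᵗ #2 ⊑ #1) (Z ∷ B ∷ A ∷ []) Z⊆ A⊆B)))
    module _ (Z : Subset n) (Z⊆ : Z ⊆ B ─ A) (c : ∣ Z ∣ ≤ r B ∸ r A) where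
      Z∩A : Z ∩ A ⊆ ∅
      Z∩A = sets (#0 ⊑ #1 ─ᵗ #2 ⊢ #0 ∩ᵗ #2 ⊑ ∅ᵗ) (Z ∷ B ∷ A ∷ []) Z⊆
      spans : (∃ λ F → IsCyclicFlat M F × ¬ F ⊆ A × r (F ∪ (Z ∪ A)) ≤ r (Z ∪ A)) → IndepOver A Z
      spans (F , c′ , F⊈A , rF) with gap F c′
      ... | inj₁ F⊆A = ⊥-elim (F⊈A F⊆A)
      ... | inj₂ B⊆F = ≤-trans (m≤o∸n⇒m+n≤o ∣ Z ∣ (r-mono A⊆B) c)
                         (≤-trans (r-mono (⊆-trans B⊆F (p⊆p∪q (Z ∪ A)))) rF)
    from : ∀ Z → Z ⊆ B ─ A → ∣ Z ∣ ≤ r B ∸ r A → Indep (minor M A B) Z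
    from Z Z⊆ c = minor⇐ A B Z Z⊆ (decidable-stable (∣ Z ∣ + r A ≤? r (Z ∪ A)) λ dep → dep
      -- Here `A` also serves as the set that the cyclic flat must leave: `Z ∩ A` is empty, hence
      -- independent over `A`.
      (spans Z Z⊆ c (dependentOver⇒cyclicFlat {A} {A} {Z}
        (⊆-trans (⊆-trans Z⊆ (p─q⊆p B A)) B⊆) (Z∩A Z Z⊆ c)
        (≤-trans (≤-reflexive (cong (_+ r A) (∣∅∣≡0 (Z∩A Z Z⊆ c)))) (r-mono (q⊆p∪q (Z ∩ A) A))) dep)))

  -- For y ∈ F ∖ A and x ∈ B ∖ F and a basis E of F ∖ y over A, the sets E ∪ x and E ∪ y have
  -- the same size, but only the first is independent over A.
  Uniform⇒Gap : ∀ {A B} → FreeSep M A → FreeSep M B → Uniform (minor M A B) → Gap M A B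
  Uniform⇒Gap {A} {B} (A⊆ , sepA) (B⊆ , sepB) (k , uni) F c with F ⊆? A | B ⊆? F | sepA F c | sepB F c
  ... | yes F⊆A | _ | _ | _ = inj₁ F⊆A
  ... | no _ | yes B⊆F | _ | _ = inj₂ B⊆F
  ... | no F⊈A | no _ | inj₁ F⊆A | _ = ⊥-elim (F⊈A F⊆A)
  ... | no _ | no B⊈F | inj₂ _ | inj₂ B⊆F = ⊥-elim (B⊈F B⊆F)
  ... | no F⊈A | no B⊈F | inj₂ A⊆F | inj₁ F⊆B =
      ⊥-elim (noBoth c A⊆F F⊆B (⊈⇒∃ F⊈A) (⊈⇒∃ B⊈F))
    where
    noBoth : ∀ {F} → IsCyclicFlat M F → A ⊆ F → F ⊆ B →
             (∃ λ y → y ∈ F × y ∉ A) → (∃ λ x → x ∈ B × x ∉ F) → ⊥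
    noBoth {F} ((F⊆ , flat) , cyc) A⊆F F⊆B (y , y∈F , y∉A) (x , x∈B , x∉F) =
      <⇒≱ (≤-trans (≤-reflexive (sym (∣E∪∣ y∉E))) iEy) (begin
        r ((E ∪ ⁅ y ⁆) ∪ A)  ≤⟨ r-mono (sets (#0 ∪ᵗ #1 ⊑ #2 ,, #3 ⊑ #2 ⊢ (#0 ∪ᵗ #3) ∪ᵗ #1 ⊑ #2) (E ∷ A ∷ F ∷ ⁅ y ⁆ ∷ []) E∪A⊆F (∈⇒⁅⁆⊆ y∈F)) ⟩
        r F                  ≤⟨ rF ⟩
        r (E ∪ A)            ≤⟨ r-∪≤′ E A ⟩
        ∣ E ∣ + r A          ∎)
      where
      open ≤-Reasoning
      relBasis = basisOver A (F ─ ⁅ y ⁆)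
      E = proj₁ relBasis
      E⊆ : E ⊆ (F ─ ⁅ y ⁆) ─ A
      E⊆ = proj₁ (proj₂ relBasis)
      iE : IndepOver A E
      iE = proj₁ (proj₂ (proj₂ relBasis))
      E∪A⊆F : E ∪ A ⊆ F
      E∪A⊆F = sets (#0 ⊑ (#1 ─ᵗ #2) ─ᵗ #3 ,, #3 ⊑ #1 ⊢ #0 ∪ᵗ #3 ⊑ #1) (E ∷ F ∷ ⁅ y ⁆ ∷ A ∷ []) E⊆ A⊆F
      rF : r F ≤ r (E ∪ A)
      rF = begin
        r F                   ≤⟨ cyclic-redundant cyc y∈F ⟩
        r (F ─ ⁅ y ⁆)         ≤⟨ r-mono (p⊆p∪q A) ⟩
        r ((F ─ ⁅ y ⁆) ∪ A)   ≤⟨ proj₂ (proj₂ (proj₂ relBasis)) ⟩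
        r (E ∪ A)             ∎
      y∉E : y ∉ E
      y∉E = ⁅⁆∩⊆∅⇒∉ (sets (#0 ⊑ (#1 ─ᵗ #2) ─ᵗ #3 ⊢ #2 ∩ᵗ #0 ⊑ ∅ᵗ) (E ∷ F ∷ ⁅ y ⁆ ∷ A ∷ []) E⊆)
      x∉E : x ∉ E
      x∉E = λ x∈E → x∉F (E∪A⊆F (p⊆p∪q A x∈E))
      E⊆B─A : E ⊆ B ─ A
      E⊆B─A = sets (#0 ⊑ (#1 ─ᵗ #2) ─ᵗ #3 ,, #1 ⊑ #4 ⊢ #0 ⊑ #4 ─ᵗ #3) (E ∷ F ∷ ⁅ y ⁆ ∷ A ∷ B ∷ []) E⊆ F⊆B
      E∪⊆ : ∀ {z} → z ∈ B → z ∉ A → E ∪ ⁅ z ⁆ ⊆ B ─ A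
      E∪⊆ {z} z∈B z∉A = sets (#0 ⊑ #1 ─ᵗ #2 ,, #3 ⊑ #1 ,, #3 ∩ᵗ #2 ⊑ ∅ᵗ ⊢ #0 ∪ᵗ #3 ⊑ #1 ─ᵗ #2)
        (E ∷ B ∷ A ∷ ⁅ z ⁆ ∷ []) E⊆B─A (∈⇒⁅⁆⊆ z∈B) (∉⇒⁅⁆∩⊆∅ z∉A)
      Ex⊆ : E ∪ ⁅ x ⁆ ⊆ B ─ A
      Ex⊆ = E∪⊆ x∈B (λ x∈A → x∉F (A⊆F x∈A))
      ∣E∪∣ : ∀ {z} → z ∉ E → ∣ E ∪ ⁅ z ⁆ ∣ + r A ≡ suc (∣ E ∣ + r A)
      ∣E∪∣ z∉E = cong (_+ r A) (∣∪⁅⁆∣ z∉E)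
      iEx : IndepOver A (E ∪ ⁅ x ⁆)
      iEx = begin
        ∣ E ∪ ⁅ x ⁆ ∣ + r A   ≡⟨ ∣E∪∣ x∉E ⟩
        suc (∣ E ∣ + r A)     ≤⟨ s≤s iE ⟩
        suc (r (E ∪ A))       ≤⟨ s≤s (r-mono E∪A⊆F) ⟩
        suc (r F)             ≤⟨ flat x (B⊆ x∈B) x∉F ⟩
        r (F ∪ ⁅ x ⁆)         ≤⟨ spanning-∪ E∪A⊆F rF ⁅ x ⁆ ⟩
        r ((E ∪ A) ∪ ⁅ x ⁆)   ≡⟨ cong r (sets (⊢ (#0 ∪ᵗ #1) ∪ᵗ #2 ≐ (#0 ∪ᵗ #2) ∪ᵗ #1) (E ∷ A ∷ ⁅ x ⁆ ∷ [])) ⟩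
        r ((E ∪ ⁅ x ⁆) ∪ A)   ∎
      iEy : IndepOver A (E ∪ ⁅ y ⁆)
      iEy = proj₂ (minor⇒ A B (E ∪ ⁅ y ⁆) (Equivalence.from (uni (E ∪ ⁅ y ⁆) (E∪⊆ (F⊆B y∈F) y∉A))
        (≤-trans (≤-reflexive (trans (∣∪⁅⁆∣ y∉E) (sym (∣∪⁅⁆∣ x∉E))))
          (Equivalence.to (uni (E ∪ ⁅ x ⁆) Ex⊆) (minor⇐ A B (E ∪ ⁅ x ⁆) Ex⊆ iEx)))))

-- Chains and paths of free separators

chain-head⊆ : ∀ {A : Subset n} {Ts} → StrictChain (A ∷ Ts) → ∀ {X} → X ∈ₗ (A ∷ Ts) → A ⊆ X
chain-head⊆ ch (here refl) = ⊆-refl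
chain-head⊆ (cons (A⊆B , _) ch) (there i) = ⊆-trans A⊆B (chain-head⊆ ch i)

chain-head∉ : ∀ {A : Subset n} {Ts} → StrictChain (A ∷ Ts) → ¬ A ∈ₗ Ts
chain-head∉ (cons (_ , x , x∈B , x∉A) ch) i = x∉A (chain-head⊆ ch i x∈B)

chain-tail : ∀ {A : Subset n} {Ts} → StrictChain (A ∷ Ts) → StrictChain Ts
chain-tail one = nil
chain-tail (cons _ ch) = ch

-- The head of a strict chain is its least member, so equal membership forces equal heads. The head
-- does not recur, so the tails again have equal membership.
chain-unique : {Xs Ys : List (Subset n)} → StrictChain Xs → StrictChain Ys →
               (∀ X → X ∈ₗ Xs ⇔ X ∈ₗ Ys) → Xs ≡ Ys
chain-unique {Xs = []} {[]} _ _ _ = refl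
chain-unique {Xs = []} {Y ∷ Ys} _ _ e with Equivalence.from (e Y) (here refl)
... | ()
chain-unique {Xs = X ∷ Xs} {[]} _ _ e with Equivalence.to (e X) (here refl)
... | ()
chain-unique {Xs = X ∷ Xs} {Y ∷ Ys} cX cY e
  with ⊆-antisym (chain-head⊆ cX (Equivalence.from (e Y) (here refl)))
                 (chain-head⊆ cY (Equivalence.to (e X) (here refl)))
... | refl = cong (X ∷_) (chain-unique (chain-tail cX) (chain-tail cY) λ Z →
        mk⇔ (λ i → drop-head cX i (Equivalence.to (e Z) (there i)))
            (λ i → drop-head cY i (Equivalence.from (e Z) (there i))))
  where
  drop-head : ∀ {Zs Ws Z} → StrictChain (X ∷ Zs) → Z ∈ₗ Zs → Z ∈ₗ (X ∷ Ws) → Z ∈ₗ Ws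
  drop-head c i (here refl) = ⊥-elim (chain-head∉ c i)
  drop-head c i (there j) = j

FreeProd-disjoint : ∀ {D : Subset n} {Ns} → All (λ N → Disjoint D (ground N)) Ns →
                    D ∩ ground (FreeProd Ns) ⊆ ∅
FreeProd-disjoint {D = D} [] = p∩q⊆q D ∅
FreeProd-disjoint {D = D} {N ∷ Ns} (d ∷ ds) =
  sets (#0 ∩ᵗ #1 ⊑ ∅ᵗ ,, #0 ∩ᵗ #2 ⊑ ∅ᵗ ⊢ #0 ∩ᵗ (#1 ∪ᵗ #2) ⊑ ∅ᵗ)
    (D ∷ ground N ∷ ground (FreeProd Ns) ∷ []) (Empty⇒⊆∅ d) (FreeProd-disjoint ds)

∈─⇒∉ : ∀ {A B : Subset n} {x} → x ∈ B ─ A → x ∉ A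
∈─⇒∉ {A = A} {B} {x} i = ⁅⁆∩⊆∅⇒∉ (sets (#2 ⊑ #0 ─ᵗ #1 ⊢ #2 ∩ᵗ #1 ⊑ ∅ᵗ) (B ∷ A ∷ ⁅ x ⁆ ∷ []) (∈⇒⁅⁆⊆ i))

factors-disjoint : ∀ (M : RawMatroid n) {D A Ts} → D ⊆ A → StrictChain (A ∷ Ts) →
                   All (λ N → Disjoint D (ground N)) (factors M (A ∷ Ts))
factors-disjoint M D⊆A one = []
factors-disjoint M {D} {A} D⊆A (cons {B = B} (A⊆B , _) ch) =
  ⊆∅⇒Empty (sets (#0 ⊑ #1 ⊢ #0 ∩ᵗ (#2 ─ᵗ #1) ⊑ ∅ᵗ) (D ∷ A ∷ B ∷ []) D⊆A)
  ∷ factors-disjoint M (⊆-trans D⊆A A⊆B) ch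

factors-DisjointGrounds : ∀ (M : RawMatroid n) {Ts} → StrictChain Ts → DisjointGrounds (factors M Ts)
factors-DisjointGrounds M nil = []
factors-DisjointGrounds M one = []
factors-DisjointGrounds M (cons {A} {B} _ ch) =
  factors-disjoint M (p─q⊆p B A) ch ∷ factors-DisjointGrounds M ch

factors-nonempty : ∀ (M : RawMatroid n) {Ts} → StrictChain Ts → All NonemptyM (factors M Ts)
factors-nonempty M nil = []
factors-nonempty M one = []
factors-nonempty M (cons (_ , x , x∈B , x∉A) ch) =
  (x , x∈p∧x∉q⇒x∈p─q x∈B x∉A) ∷ factors-nonempty M ch

-- The slice condition phrased by concatenation instead of indices, which matches the way paths are
-- split and joined.
NoUniformRun : List (RawMatroid n) → Set
NoUniformRun Ms = ∀ xs ys zs → Ms ≡ xs ++ (ys ++ zs) → 2 ≤ length ys → ¬ Uniform (FreeProd ys)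

NoUniformSlice : List (RawMatroid n) → Set
NoUniformSlice Ms =
  ∀ i j → i + 2 ≤ j → j ≤ length Ms → ¬ Uniform (FreeProd (take (j ∸ i) (drop i Ms)))

run⇒slice : {Ms : List (RawMatroid n)} → NoUniformRun Ms → NoUniformSlice Ms
run⇒slice {Ms = Ms} run i j i+2≤j j≤ = run (take i Ms) ys (drop (j ∸ i) (drop i Ms))
  (trans (sym (take++drop≡id i Ms)) (cong (take i Ms ++_) (sym (take++drop≡id (j ∸ i) (drop i Ms)))))
  (subst (2 ≤_) (sym length-ys) (m+n≤o⇒m≤o∸n 2 (≤-trans (≤-reflexive (+-comm 2 i)) i+2≤j)))
  where
  ys = take (j ∸ i) (drop i Ms)
  length-ys : length ys ≡ j ∸ i
  length-ys = trans (length-take (j ∸ i) (drop i Ms))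
    (m≤n⇒m⊓n≡m (≤-trans (∸-monoˡ-≤ i j≤) (≤-reflexive (sym (length-drop i Ms)))))

slice⇒run : {Ms : List (RawMatroid n)} → NoUniformSlice Ms → NoUniformRun Ms
slice⇒run slice xs ys zs refl 2≤ u = slice (length xs) (length xs + length ys)
  (+-monoʳ-≤ (length xs) 2≤)
  (≤-trans (+-monoʳ-≤ (length xs) (≤-trans (m≤m+n _ (length zs)) (≤-reflexive (sym (length-++ ys)))))
           (≤-reflexive (sym (length-++ xs))))
  (subst (λ Ns → Uniform (FreeProd Ns)) (sym same) u)
  where
  drop-++ : ∀ {A : Set} (xs : List A) {ys} → drop (length xs) (xs ++ ys) ≡ ys
  drop-++ [] = refl
  drop-++ (_ ∷ xs) = drop-++ xs
  take-++ : ∀ {A : Set} (xs : List A) {ys} → take (length xs) (xs ++ ys) ≡ xs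
  take-++ [] = refl
  take-++ (x ∷ xs) = cong (x ∷_) (take-++ xs)
  same : take (length xs + length ys ∸ length xs) (drop (length xs) (xs ++ (ys ++ zs))) ≡ ys
  same = trans (cong₂ take (m+n∸m≡n (length xs) (length ys)) (drop-++ xs)) (take-++ ys)

-- Factorizations as paths

module Paths {n : ℕ} (M : RawMatroid n) (isM : IsMatroid M) where
  open IsMatroid isM
  open MatroidRank M isM
  open Minors M isM
  open MinorProduct M isM
  open Separators M isM

  -- Steps ask for `A ⊆ B` only, since the factorizations in `Irreducible` may contain empty
  -- matroids, which stay at the same point. Strictness comes from `NonemptyM` where it is
  -- available. The predicate is `FreeSep M` or `IsPinchpoint M`.
  data Path (P : Subset n → Set) : Subset n → List (RawMatroid n) → Subset n → Set where
    []   : ∀ {A} → P A → Path P A [] A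
    step : ∀ {A B C N Ns} → P A → A ⊆ B → N ≅ minor M A B → Path P B Ns C → Path P A (N ∷ Ns) C

  private
    variable
      P P′    : Subset n → Set
      A B C X : Subset n
      Ns Ns′  : List (RawMatroid n)

  tail-points : Path P A Ns C → List (Subset n)
  tail-points ([] _) = []
  tail-points (step {B = B} _ _ _ p) = B ∷ tail-points p

  points : Path P A Ns C → List (Subset n)
  points {A = A} p = A ∷ tail-points p

  start : Path P A Ns C → P A
  start ([] h) = h
  start (step h _ _ _) = h

  end : Path P A Ns C → P C
  end ([] h) = h
  end (step _ _ _ p) = end p

  points-satisfy : (p : Path P A Ns C) → X ∈ₗ points p → P X
  points-satisfy p (here refl) = start p
  points-satisfy (step _ _ _ p) (there i) = points-satisfy p i

  start⊆end : Path P A Ns C → A ⊆ C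
  start⊆end ([] _) = ⊆-refl
  start⊆end (step _ A⊆B _ p) = ⊆-trans A⊆B (start⊆end p)

  map-path : (∀ {X} → P X → P′ X) → Path P A Ns C → Path P′ A Ns C
  map-path f ([] h) = [] (f h)
  map-path f (step h s e p) = step (f h) s e (map-path f p)

  _++ᵖ_ : Path P A Ns B → Path P B Ns′ C → Path P A (Ns ++ Ns′) C
  [] _ ++ᵖ q = q
  step h s e p ++ᵖ q = step h s e (p ++ᵖ q)

  splitAt-point : (p : Path P A Ns C) → X ∈ₗ points p →
    ∃ λ Ns₁ → ∃ λ Ns₂ → Ns ≡ Ns₁ ++ Ns₂ × Path P A Ns₁ X × Path P X Ns₂ C
  splitAt-point p (here refl) = [] , _ , refl , [] (start p) , p
  splitAt-point (step {N = N} h s e p) (there i) with splitAt-point p i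
  ... | Ns₁ , Ns₂ , eq , p₁ , p₂ = N ∷ Ns₁ , Ns₂ , cong (N ∷_) eq , step h s e p₁ , p₂

  split-++ : ∀ Ns₁ {Ns₂} → Path P A (Ns₁ ++ Ns₂) C → ∃ λ B → Path P A Ns₁ B × Path P B Ns₂ C
  split-++ [] p = _ , [] (start p) , p
  split-++ (N ∷ Ns₁) (step h s e p) with split-++ Ns₁ p
  ... | B , p₁ , p₂ = B , step h s e p₁ , p₂

  nonempty⇒⊂ : ∀ {N} → A ⊆ B → N ≅ minor M A B → NonemptyM N → A ⊂ B
  nonempty⇒⊂ {A} {B} A⊆B (g , _) (x , x∈) =
    let x∈B─A = subst (x ∈_) g x∈ in A⊆B , x , p─q⊆p B A x∈B─A , ∈─⇒∉ x∈B─A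

  points-chain : (p : Path P A Ns C) → All NonemptyM Ns → StrictChain (points p)
  points-chain ([] _) [] = one
  points-chain (step _ s e p) (ne ∷ nes) = cons (nonempty⇒⊂ s e ne) (points-chain p nes)

  points-factors : (p : Path P A Ns C) → Pointwise _≅_ Ns (factors M (points p))
  points-factors ([] _) = []
  points-factors (step _ _ e p) = e ∷ points-factors p

  minor-self : minor M A A ≅ emptyM
  minor-self {A} = A─A , λ I → ⇔⇒≡
    (λ h → ⌊⌋-true (I ⊆? ∅) (⊆-trans (proj₁ (minor⇒ A A I h)) (⊆-reflexive A─A)))
    (λ h → empty I (true-⌊⌋ (I ⊆? ∅) h))
    where
    A─A : A ─ A ≡ ∅
    A─A = sets (⊢ #0 ─ᵗ #0 ≐ ∅ᵗ) (A ∷ [])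
    empty : ∀ I → I ⊆ ∅ → Indep (minor M A A) I
    empty I I⊆ = subst (Indep (minor M A A)) (sym (⊆∅⇒≡∅ I⊆)) (minor-∅ A A)

  minor-∅-ground : minor M ∅ (ground M) ≅ M
  minor-∅-ground = sets (⊢ #0 ─ᵗ ∅ᵗ ≐ #0) (ground M ∷ []) , λ I → ⇔⇒≡
    (λ h → ∣∣≤r⇒Indep (≤-trans (m≤m+n ∣ I ∣ (r ∅))
              (≤-trans (proj₂ (minor⇒ ∅ (ground M) I h)) (≤-reflexive (cong r (∪∅ I))))))
    (λ h → minor⇐ ∅ (ground M) I (⊆-trans (indep⊆ground I h) (sets (⊢ #0 ⊑ #0 ─ᵗ ∅ᵗ) (ground M ∷ [])))
      (≤-trans (≤-reflexive (trans (cong (∣ I ∣ +_) r∅) (+-identityʳ ∣ I ∣)))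
               (Indep⇒∣∣≤r (p⊆p∪q ∅) h)))
    where
    ∪∅ : ∀ I → I ∪ ∅ ≡ I
    ∪∅ I = sets (⊢ #0 ∪ᵗ ∅ᵗ ≐ #0) (I ∷ [])
    r∅ : r ∅ ≡ 0
    r∅ = n≤0⇒n≡0 (≤-trans (r≤∣∣ ∅) (≤-reflexive (∣⊥∣≡0 n)))

  path⇒FreeProd : Path (FreeSep M) A Ns C → minor M A C ≅ FreeProd Ns
  path⇒FreeProd ([] _) = minor-self
  path⇒FreeProd (step {A} {B} {C} {N} {Ns} _ A⊆B e p) =
    ≅-trans {M = minor M A C} {minor M A B □ minor M B C} {N □ FreeProd Ns}
      (minor-□ A⊆B (start⊆end p) (proj₁ (end p)) (start p))
      (□-cong (≅-sym {M = N} {minor M A B} e) (path⇒FreeProd p))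

  -- `Split` removes the head and returns a new free separator from which the tail is again a minor
  -- up to `C`, so the recursion moves the lower end upwards.
  FreeProd⇒path : All IsMatroid Ns → DisjointGrounds Ns → A ⊆ C → FreeSep M A → FreeSep M C →
                  minor M A C ≅ FreeProd Ns → Path (FreeSep M) A Ns C
  FreeProd⇒path {A = A} {C} [] [] A⊆C sepA sepC (g , _) =
    subst (Path (FreeSep M) A [])
      (⊆-antisym A⊆C (sets (#1 ─ᵗ #0 ≐ ∅ᵗ ⊢ #1 ⊑ #0) (A ∷ C ∷ []) g)) ([] sepA)
  FreeProd⇒path {N ∷ Ns} {A} {C} (m ∷ ms) (d ∷ ds) A⊆C sepA sepC e =
    step sepA S.A⊆B S.P≅ (FreeProd⇒path ms ds S.B⊆C S.sepB sepC
      (≅-sym {M = FreeProd Ns} {minor M S.B C} S.Q≅))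
    where
    module S = Split A⊆C sepA sepC N (FreeProd Ns) (IsMatroid.indep-∅ m) (FreeProd-∅ ms)
                 (IsMatroid.indep⊆ground m) (FreeProd-⊆ ms) (FreeProd-disjoint d) e

  -- In the uniform case the gap from `A` to `B` excludes lattice members strictly between. In the
  -- irreducible case cutting at `X` gives two factors, one of which must have the whole ground set.
  irreducible-or-uniform⇒adjacent : ∀ {N} → FreeSep M A → FreeSep M B → IsPinchpoint M X →
    A ⊆ X → X ⊆ B → N ≅ minor M A B → Irreducible N ⊎ Uniform N → X ≡ A ⊎ X ≡ B
  irreducible-or-uniform⇒adjacent {A} {B} {X} {N} sepA sepB pX A⊆X X⊆B e (inj₂ u)
    with Gap⇒InD (proj₁ sepB) (Uniform⇒Gap sepA sepB (Uniform-cong e u)) (proj₁ pX)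
  ... | inj₁ X⊆A = inj₁ (⊆-antisym X⊆A A⊆X)
  ... | inj₂ B⊆X = inj₂ (⊆-antisym X⊆B B⊆X)
  irreducible-or-uniform⇒adjacent {A} {B} {X} {N} sepA sepB pX A⊆X X⊆B e (inj₁ (_ , irr)) =
    decide (irr (minor M A X ∷ minor M X B ∷ [])
      ( minor-isMatroid A X ∷ minor-isMatroid X B ∷ []
      , (⊆∅⇒Empty (sets (⊢ (#1 ─ᵗ #0) ∩ᵗ (#2 ─ᵗ #1) ⊑ ∅ᵗ) (A ∷ X ∷ B ∷ [])) ∷ []) ∷ [] ∷ []
      , ≅-trans {M = N} {minor M A B} e (path⇒FreeProd
          (step sepA A⊆X ≅-refl (step (pinchpoint⇒FreeSep pX) X⊆B ≅-refl ([] sepB))))))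
    where
    decide : Any (λ N′ → N′ ≅ N) (minor M A X ∷ minor M X B ∷ []) → X ≡ A ⊎ X ≡ B
    decide (here (g , _)) = inj₂ (⊆-antisym X⊆B
      (sets (#0 ⊑ #1 ,, #1 ─ᵗ #0 ≐ #2 ─ᵗ #0 ⊢ #2 ⊑ #1) (A ∷ X ∷ B ∷ []) A⊆X (trans g (proj₁ e))))
    decide (there (here (g , _))) = inj₁ (⊆-antisym
      (sets (#1 ⊑ #2 ,, #2 ─ᵗ #1 ≐ #2 ─ᵗ #0 ⊢ #1 ⊑ #0) (A ∷ X ∷ B ∷ []) X⊆B (trans g (proj₁ e))) A⊆X)

  pinchpoint∈points : IsPinchpoint M X → (p : Path (FreeSep M) A Ns C) →
    All (λ N → Irreducible N ⊎ Uniform N) Ns → A ⊆ X → X ⊆ C → X ∈ₗ points p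
  pinchpoint∈points pX ([] _) _ A⊆X X⊆A = here (⊆-antisym X⊆A A⊆X)
  pinchpoint∈points pX (step sepA A⊆B e p) (iu ∷ ius) A⊆X X⊆C
    with FreeSep⇒comparable (start p) (proj₁ pX)
  ... | inj₂ B⊆X = there (pinchpoint∈points pX p ius B⊆X X⊆C)
  ... | inj₁ X⊆B with irreducible-or-uniform⇒adjacent sepA (start p) pX A⊆X X⊆B e iu
  ...   | inj₁ X≡A = here X≡A
  ...   | inj₂ X≡B = there (here X≡B)

  path-≢⇒length : Path P A Ns C → A ≢ C → 1 ≤ length Ns
  path-≢⇒length ([] _) A≢A = ⊥-elim (A≢A refl)
  path-≢⇒length (step _ _ _ _) _ = s≤s z≤n

  -- A free separator X that is not in the lattice lies strictly between two pinchpoints U and V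
  -- with nothing in between, and then the factors between U and V multiply to a uniform matroid.
  points-pinchpoints : (p : Path (FreeSep M) ∅ Ns (ground M)) →
    All (λ N → Irreducible N ⊎ Uniform N) Ns → NoUniformRun Ns →
    X ∈ₗ points p → IsPinchpoint M X
  points-pinchpoints {Ns} {X} p ius run i = decide (pinchpoints-around sepX)
    where
    sepX : FreeSep M X
    sepX = points-satisfy p i

    decide : (∃ λ U → ∃ λ V → IsPinchpoint M U × IsPinchpoint M V × U ⊆ X × X ⊆ V × Gap M U V) →
             IsPinchpoint M X
    decide (U , V , pU , pV , U⊆X , X⊆V , gap) with ≡-dec _≟ᵇ_ U X | ≡-dec _≟ᵇ_ X V
    ... | yes refl | _ = pU
    ... | no _ | yes refl = pV
    ... | no U≢X | no X≢V with splitAt-point p i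
    ...   | Ns₁ , Ns₂ , refl , p₁ , p₂
            with splitAt-point p₁ (pinchpoint∈points pU p₁ (++⁻ˡ Ns₁ ius) ⊥⊆ U⊆X)
               | splitAt-point p₂ (pinchpoint∈points pV p₂ (++⁻ʳ Ns₁ ius) X⊆V (InD⇒⊆ground (proj₁ pV)))
    ...     | K₁ , K₂ , refl , q₁ , q₂ | L₁ , L₂ , refl , q₃ , q₄ =
              ⊥-elim (run K₁ (K₂ ++ L₁) L₂
                (trans (++-assoc K₁ K₂ (L₁ ++ L₂)) (cong (K₁ ++_) (sym (++-assoc K₂ L₁ L₂))))
                (≤-trans (+-mono-≤ (path-≢⇒length q₂ U≢X) (path-≢⇒length q₃ X≢V))
                         (≤-reflexive (sym (length-++ K₂))))
                (Uniform-cong (path⇒FreeProd (q₂ ++ᵖ q₃))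
                  (Gap⇒Uniform (⊆-trans U⊆X X⊆V) (InD⇒⊆ground (proj₁ pV)) gap)))

  uniform-path⇒Gap : Path (FreeSep M) A Ns C → Uniform (FreeProd Ns) → Gap M A C
  uniform-path⇒Gap {A} {Ns} {C} p u = Uniform⇒Gap (start p) (end p)
    (Uniform-cong {M = FreeProd Ns} {minor M A C}
      (≅-sym {M = minor M A C} {FreeProd Ns} (path⇒FreeProd p)) u)

  -- A run of at least two nonempty factors passes through a pinchpoint strictly between its ends,
  -- while uniformity would put a gap there.
  pinchpoint-path⇒NoUniformRun : Path (IsPinchpoint M) A Ns C → All NonemptyM Ns → NoUniformRun Ns
  pinchpoint-path⇒NoUniformRun p nes xs ys zs refl 2≤ u =
    let (_ , _ , q) = split-++ xs p
        (_ , q′ , _) = split-++ ys q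
    in nonuniform q′ (++⁻ˡ ys (++⁻ʳ xs nes)) 2≤ u
    where
    outside⇒⊥ : ∀ {A B C : Subset n} → A ⊂ B → B ⊂ C → B ⊆ A ⊎ C ⊆ B → ⊥
    outside⇒⊥ (_ , x , x∈B , x∉A) _ (inj₁ B⊆A) = x∉A (B⊆A x∈B)
    outside⇒⊥ _ (_ , x , x∈C , x∉B) (inj₂ C⊆B) = x∉B (C⊆B x∈C)
    nonuniform : ∀ {A ys C} → Path (IsPinchpoint M) A ys C → All NonemptyM ys → 2 ≤ length ys →
                 ¬ Uniform (FreeProd ys)
    nonuniform q@(step _ A⊆B e q₁@(step _ B⊆B′ e′ q₂)) (ne ∷ ne′ ∷ _) _ u =
      outside⇒⊥ (nonempty⇒⊂ A⊆B e ne) (⊂-⊆-trans (nonempty⇒⊂ B⊆B′ e′ ne′) (start⊆end q₂))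
        (Gap⇒InD (InD⇒⊆ground (proj₁ (end q)))
          (uniform-path⇒Gap (map-path pinchpoint⇒FreeSep q) u) (proj₁ (start q₁)))
    nonuniform (step _ _ _ ([] _)) _ (s≤s ()) _

  FreeSep? : ∀ X → Dec (FreeSep M X)
  FreeSep? X with X ⊆? ground M
    | anySubset? (λ F → cyclicFlat? F ×-dec (¬? (F ⊆? X) ×-dec ¬? (X ⊆? F)))
  ... | no X⊈ | _ = no (λ sep → X⊈ (proj₁ sep))
  ... | yes _ | yes (F , c , F⊈X , X⊈F) =
        no (λ sep → case proj₂ sep F c of λ where
          (inj₁ F⊆X) → F⊈X F⊆X
          (inj₂ X⊆F) → X⊈F X⊆F)
  ... | yes X⊆ | no none = yes (X⊆ , compare)
    where
    compare : ∀ F → IsCyclicFlat M F → F ⊆ X ⊎ X ⊆ F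
    compare F c with F ⊆? X | X ⊆? F
    ... | yes F⊆X | _ = inj₁ F⊆X
    ... | no _ | yes X⊆F = inj₂ X⊆F
    ... | no F⊈X | no X⊈F = ⊥-elim (none (F , c , F⊈X , X⊈F))

  -- Steps that stay at `A` are empty factors; the first step that leaves `A` lands at `C` and is
  -- the whole minor.
  path-between-adjacent : (∀ X → FreeSep M X → A ⊆ X → X ⊆ C → X ≡ A ⊎ X ≡ C) → A ≢ C →
    Path (FreeSep M) A Ns C → Any (λ N → N ≅ minor M A C) Ns
  path-between-adjacent adj A≢C ([] _) = ⊥-elim (A≢C refl)
  path-between-adjacent adj A≢C (step _ A⊆B e p) with adj _ (start p) A⊆B (start⊆end p)
  ... | inj₁ refl = there (path-between-adjacent adj A≢C p)
  ... | inj₂ refl = here e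

  -- The decision is whether a free separator `X` lies strictly between. If so, the pinchpoints
  -- around `X` are squeezed onto `A` and `B`, whose gap gives uniformity. If not, every
  -- factorization of the minor is a path without interior points.
  adjacent-pinchpoints : IsPinchpoint M A → IsPinchpoint M B → A ⊂ B →
    (∀ X → IsPinchpoint M X → A ⊆ X → X ⊆ B → X ≡ A ⊎ X ≡ B) →
    Irreducible (minor M A B) ⊎ Uniform (minor M A B)
  adjacent-pinchpoints {A} {B} pA pB (A⊆B , x , x∈B , x∉A) adj
    with anySubset? (λ X → FreeSep? X ×-dec ((A ⊆? X) ×-dec ((X ⊆? B) ×-dec
                             (¬? (≡-dec _≟ᵇ_ X A) ×-dec ¬? (≡-dec _≟ᵇ_ X B)))))
  ... | yes (X , sepX , A⊆X , X⊆B , X≢A , X≢B) = inj₂ (uniform (pinchpoints-around sepX))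
    where
    -- `V ⊆ A` would force `X = A`, so the gap leaves `A ⊆ U`. Adjacency then puts `U` at `A`,
    -- because `U = B` would force `X = B`.
    lower : ∀ {U V} → IsPinchpoint M U → U ⊆ X → X ⊆ V → Gap M U V → V ⊆ ground M → U ≡ A
    lower pU U⊆X X⊆V gap V⊆ with Gap⇒InD V⊆ gap (proj₁ pA)
    ... | inj₂ V⊆A = ⊥-elim (X≢A (⊆-antisym (⊆-trans X⊆V V⊆A) A⊆X))
    ... | inj₁ A⊆U with adj _ pU A⊆U (⊆-trans U⊆X X⊆B)
    ...   | inj₁ U≡A = U≡A
    ...   | inj₂ refl = ⊥-elim (X≢B (⊆-antisym X⊆B U⊆X))
    upper : ∀ {U V} → IsPinchpoint M V → U ⊆ X → X ⊆ V → Gap M U V → V ≡ B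
    upper pV U⊆X X⊆V gap with Gap⇒InD (InD⇒⊆ground (proj₁ pV)) gap (proj₁ pB)
    ... | inj₁ B⊆U = ⊥-elim (X≢B (⊆-antisym X⊆B (⊆-trans B⊆U U⊆X)))
    ... | inj₂ V⊆B with adj _ pV (⊆-trans A⊆X X⊆V) V⊆B
    ...   | inj₂ V≡B = V≡B
    ...   | inj₁ refl = ⊥-elim (X≢A (⊆-antisym X⊆V A⊆X))
    uniform : (∃ λ U → ∃ λ V → IsPinchpoint M U × IsPinchpoint M V × U ⊆ X × X ⊆ V × Gap M U V) →
              Uniform (minor M A B)
    uniform (U , V , pU , pV , U⊆X , X⊆V , gap) = Gap⇒Uniform A⊆B (InD⇒⊆ground (proj₁ pB))
      (subst₂ (Gap M) (lower pU U⊆X X⊆V gap (InD⇒⊆ground (proj₁ pV))) (upper pV U⊆X X⊆V gap) gap)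
  ... | no none = inj₁ ((x , x∈p∧x∉q⇒x∈p─q x∈B x∉A) , λ Ns (ms , ds , e) →
        path-between-adjacent sepAdj (λ { refl → x∉A x∈B })
          (FreeProd⇒path ms ds A⊆B (pinchpoint⇒FreeSep pA) (pinchpoint⇒FreeSep pB) e))
    where
    sepAdj : ∀ X → FreeSep M X → A ⊆ X → X ⊆ B → X ≡ A ⊎ X ≡ B
    sepAdj X sepX A⊆X X⊆B with ≡-dec _≟ᵇ_ X A | ≡-dec _≟ᵇ_ X B
    ... | yes X≡A | _ = inj₁ X≡A
    ... | no _ | yes X≡B = inj₂ X≡B
    ... | no X≢A | no X≢B = ⊥-elim (none (X , sepX , A⊆X , X⊆B , X≢A , X≢B))

  -- The primary flag and its factors

  factors-matroid : ∀ Ts → All IsMatroid (factors M Ts)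
  factors-matroid [] = []
  factors-matroid (_ ∷ []) = []
  factors-matroid (A ∷ B ∷ Ts) = minor-isMatroid A B ∷ factors-matroid (B ∷ Ts)

  chain-path : ∀ {Ts} → StrictChain (A ∷ Ts) → (∀ {X} → X ∈ₗ (A ∷ Ts) → P X) →
    ∃ λ C → Path P A (factors M (A ∷ Ts)) C × (∀ {X} → X ∈ₗ (A ∷ Ts) → X ⊆ C)
  chain-path {A} one h = A , [] (h (here refl)) , λ { (here refl) → ⊆-refl }
  chain-path (cons (A⊆B , _) ch) h with chain-path ch (λ i → h (there i))
  ... | C , p , ⊆C = C , step (h (here refl)) A⊆B ≅-refl p ,
        λ { (here refl) → ⊆-trans A⊆B (⊆C (here refl)) ; (there i) → ⊆C i }

  -- Completeness is required only for pinchpoints above `A`, so that it is inherited when the head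
  -- of the chain is dropped.
  chain-irreducible-or-uniform : ∀ {Ts} → StrictChain (A ∷ Ts) →
    (∀ {X} → X ∈ₗ (A ∷ Ts) → IsPinchpoint M X) → (∀ {X} → IsPinchpoint M X → A ⊆ X → X ∈ₗ (A ∷ Ts)) →
    All (λ N → Irreducible N ⊎ Uniform N) (factors M (A ∷ Ts))
  chain-irreducible-or-uniform one _ _ = []
  chain-irreducible-or-uniform (cons {A} {B} {Ts} A⊂B@(A⊆B , x , x∈B , x∉A) ch) sound complete =
    adjacent-pinchpoints (sound (here refl)) (sound (there (here refl))) A⊂B adj
    ∷ chain-irreducible-or-uniform ch (λ i → sound (there i)) complete′
    where
    adj : ∀ X → IsPinchpoint M X → A ⊆ X → X ⊆ B → X ≡ A ⊎ X ≡ B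
    adj X pX A⊆X X⊆B with complete pX A⊆X
    ... | here X≡A = inj₁ X≡A
    ... | there i = inj₂ (⊆-antisym X⊆B (chain-head⊆ ch i))
    complete′ : ∀ {X} → IsPinchpoint M X → B ⊆ X → X ∈ₗ (B ∷ Ts)
    complete′ pX B⊆X with complete pX (⊆-trans A⊆B B⊆X)
    ... | here refl = ⊥-elim (x∉A (B⊆X x∈B))
    ... | there i = i

  module _ {Ts} (flag : IsPrimaryFlag M Ts) where
    private
      sound : ∀ {X} → X ∈ₗ Ts → IsPinchpoint M X
      sound = Equivalence.to (proj₂ flag _)

      complete : ∀ {X} → IsPinchpoint M X → X ∈ₗ Ts
      complete = Equivalence.from (proj₂ flag _)

    flag-path : Path (IsPinchpoint M) ∅ (factors M Ts) (ground M) ×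
                All (λ N → Irreducible N ⊎ Uniform N) (factors M Ts)
    flag-path = build Ts (proj₁ flag) sound complete
      where
      build : ∀ Ts → StrictChain Ts → (∀ {X} → X ∈ₗ Ts → IsPinchpoint M X) →
        (∀ {X} → IsPinchpoint M X → X ∈ₗ Ts) →
        Path (IsPinchpoint M) ∅ (factors M Ts) (ground M) ×
        All (λ N → Irreducible N ⊎ Uniform N) (factors M Ts)
      build [] ch sound complete with complete (∅-pinchpoint M)
      ... | ()
      build (A ∷ Ts) ch sound complete
        -- `∅` and the ground set are pinchpoints, so both occur in the chain. The head is contained
        -- in the former and the end point contains the latter, which fixes the two ends of the
        -- path.
        with ⊆∅⇒≡∅ (chain-head⊆ ch (complete (∅-pinchpoint M))) | chain-path ch sound
      ... | refl | C , p , ⊆C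
        with ⊆-antisym (⊆C (complete (ground-pinchpoint M))) (InD⇒⊆ground (proj₁ (end p)))
      ...   | refl = p , chain-irreducible-or-uniform ch sound (λ pX _ → complete pX)

    factors-good : GoodDecomposition M (factors M Ts)
    factors-good =
      (factors-matroid Ts , factors-DisjointGrounds M (proj₁ flag) ,
       ≅-trans {M = M} {minor M ∅ (ground M)} (≅-sym {M = minor M ∅ (ground M)} {M} minor-∅-ground)
         (path⇒FreeProd (map-path pinchpoint⇒FreeSep (proj₁ flag-path)))) ,
      factors-nonempty M (proj₁ flag) , proj₂ flag-path ,
      run⇒slice (pinchpoint-path⇒NoUniformRun (proj₁ flag-path) (factors-nonempty M (proj₁ flag)))

    -- Under these conditions the points of the path are exactly the pinchpoints. Two strict chains
    -- with the same members coincide, and the factors are determined by the points.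
    path≅factors : Path (FreeSep M) ∅ Ns (ground M) → All NonemptyM Ns →
      All (λ N → Irreducible N ⊎ Uniform N) Ns → NoUniformRun Ns → Pointwise _≅_ Ns (factors M Ts)
    path≅factors {Ns} p nes ius run =
      subst (λ Xs → Pointwise _≅_ Ns (factors M Xs))
        (chain-unique (points-chain p nes) (proj₁ flag) (λ X → mk⇔
          (λ i → complete (points-pinchpoints p ius run i))
          (λ i → pinchpoint∈points (sound i) p ius ⊥⊆ (InD⇒⊆ground (proj₁ (sound i))))))
        (points-factors p)

    good⇒factors : ∀ Ms → GoodDecomposition M Ms → Pointwise _≅_ Ms (factors M Ts)
    good⇒factors Ms ((ms , ds , e) , nes , ius , slice) = path≅factors
      (FreeProd⇒path ms ds ⊥⊆
        (pinchpoint⇒FreeSep (∅-pinchpoint M)) (pinchpoint⇒FreeSep (ground-pinchpoint M))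
        (≅-trans {M = minor M ∅ (ground M)} {M} {FreeProd Ms} minor-∅-ground e))
      nes ius (slice⇒run slice)

theorem6p16 : ∀ {n : ℕ} (M : RawMatroid n) (Ts : List (Subset n)) →
    IsMatroid M → IsPrimaryFlag M Ts →
    GoodDecomposition M (factors M Ts) ×
    (∀ (Ms : List (RawMatroid n)) → GoodDecomposition M Ms →
    Pointwise _≅_ Ms (factors M Ts))
theorem6p16 M Ts isM flag = Paths.factors-good M isM flag , Paths.good⇒factors M isM flag
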